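{- For integers $r\ge 1$, $t\ge 2$, $y\ge \max\{r,2\}$, $z\ge 0$ with $\lambda=q^{y}$, $y\le k$, $k=\frac{q^r-1}{q-1}+1-z>r$, $v=kt+r$, and $l=\frac{q^{v-k}-q^r}{q^k-1}$, we have $$\mathrm{A}_q(v,2k;k)\le lq^k+\left\lceil \lambda -\frac{1}{2}-\frac{1}{2}\sqrt{1+4\lambda\left(\lambda-(z+y-1)(q-1)-1\right)} \right\rceil.$$
   Context: $q>1$ is a prime power. $\mathrm{A}_q(v,2k;k)$ denotes the maximum size of a partial $k$-spread in $\mathbb{F}_q^v$, i.e. of a set of $k$-dimensional subspaces of $\mathbb{F}_q^v$ with pairwise trivial (zero) intersection. -}

module Defs where

open import Data.Nat using (ℕ)
open import Data.Fin using (Fin; zero; suc)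
open import Data.Integer using (ℤ; _≤_; _<_; _*_; _+_; _-_) renaming (+_ to ⁺)
open import Data.Sum using (_⊎_)
open import Data.Product using (_×_)
open import Relation.Binary.PropositionalEquality using (_≡_)
open import Relation.Nullary using (¬_)
open import Function.Bundles using (_↔_)
open import Algebra.Structures using (IsCommutativeRing)

record FiniteField (q : ℕ) : Set₁ where
  field
    F        : Set
    _+F_     : F → F → F
    _*F_     : F → F → F
    -F_      : F → F
    0F       : F
    1F       : F
    isCommutativeRing : IsCommutativeRing _≡_ _+F_ _*F_ -F_ 0F 1F
    0≢1      : ¬ (0F ≡ 1F)
    inv      : (x : F) → ¬ (x ≡ 0F) → F
    inv-*    : (x : F) (nz : ¬ (x ≡ 0F)) → x *F inv x nz ≡ 1F
    card     : F ↔ Fin q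

module _ {q : ℕ} (K : FiniteField q) where
  open FiniteField K

  Vect : ℕ → Set
  Vect v = Fin v → F

  lincomb : {k v : ℕ} → (Fin k → F) → (Fin k → Vect v) → Vect v
  lincomb {ℕ.zero}  c b j = 0F
  lincomb {ℕ.suc k} c b j = (c zero *F b zero j) +F lincomb (λ i → c (suc i)) (λ i → b (suc i)) j

  -- a k-dimensional subspace of F_q^v, given by a basis (k linearly independent vectors)
  LinIndep : {k v : ℕ} → (Fin k → Vect v) → Set
  LinIndep {k} {v} b = (c : Fin k → F) → (∀ j → lincomb c b j ≡ 0F) → ∀ i → c i ≡ 0F

  TrivialIntersection : {k v : ℕ} → (Fin k → Vect v) → (Fin k → Vect v) → Set
  TrivialIntersection {k} {v} b b' =
    (c d : Fin k → F) → (∀ j → lincomb c b j ≡ lincomb d b' j) → ∀ j → lincomb c b j ≡ 0F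

  -- a partial k-spread in F_q^v of size n: n k-dim subspaces with pairwise trivial intersection
  -- (for k ≥ 1 these subspaces are automatically pairwise distinct)
  record PartialSpread (v k n : ℕ) : Set where
    field
      basis    : Fin n → Fin k → Vect v
      indep    : ∀ i → LinIndep (basis i)
      disjoint : ∀ i j → ¬ (i ≡ j) → TrivialIntersection (basis i) (basis j)

LeSqrt : ℤ → ℤ → Set
LeSqrt a D = a ≤ ⁺ 0 ⊎ a * a ≤ D

GtSqrt : ℤ → ℤ → Set
GtSqrt a D = ⁺ 0 < a × D < a * a

-- c = ⌈ λ - 1/2 - (1/2)√D ⌉  (for D ≥ 0), i.e.
--   λ - 1/2 - √D/2 ≤ c   ⇔  2λ - 1 - 2c ≤ √D
--   c - 1 < λ - 1/2 - √D/2 ⇔ 2λ + 1 - 2c > √D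
IsCeilExpr : ℤ → ℤ → ℤ → Set
IsCeilExpr lam D c =
  LeSqrt (⁺ 2 * lam - ⁺ 1 - ⁺ 2 * c) D ×
  GtSqrt (⁺ 2 * lam + ⁺ 1 - ⁺ 2 * c) D

{-# OPTIONS --safe #-}
module Submission where

-- Let h(U) be the number of nonzero vectors of a subspace U covered by no member of the spread.
-- If the spread has l q^k + X + 1 members and X < q^e, where e = k − codim U, then
-- h(U) = X + q^e w with q − 1 dividing X + w.  Some hyperplane section of U has at most h(U)/q
-- holes, which lowers w by at least q − 1; starting from X + w + 1 = q^r on the whole space, k − y
-- such steps reach e = y with X + w ≤ (q − 1)(z + y − 1).  There, the number τ of holes in a
-- hyperplane section takes no value strictly between g − (q − 1) q^(y−1) and g = X + q^(y−1) w, so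
-- (τ − g)(τ − g + (q − 1) q^(y−1)) ≥ 0 everywhere.  Summing this over all functionals by means of
-- the first two moments of τ gives X² + X + λ w ≥ λ X, strictly if w > 0 because of the zero
-- functional.  For X the value of the ceiling this contradicts the bound on X + w.

open import Defs
open import Data.Nat using (ℕ; zero; suc; _+_; _*_; _∸_; _^_; _≤_; _<_; _⊔_; z≤n; s≤s; z<s; s≤s⁻¹; NonZero; >-nonZero)
open import Data.Integer using (ℤ; +≤+; +<+; -[1+_]; drop‿+≤+) renaming (_≤_ to _≤ᶻ_; _<_ to _<ᶻ_; _+_ to _+ᶻ_; _*_ to _*ᶻ_; _-_ to _-ᶻ_; -_ to -ᶻ_; +_ to ⁺)
open import Algebra.Bundles using (CommutativeRing)
open import Data.Bool using (if_then_else_)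
open import Data.Fin as Fin using (Fin; zero; suc)
import Data.Fin.Properties as Finₚ
import Data.Integer.Properties as ℤₚ
import Data.Integer.Tactic.RingSolver as ℤSolver
open import Data.Nat.Divisibility using (_∣_; divides; ∣m+n∣m⇒∣n; ∣⇒≤; n∣m*n)
open import Data.Nat.Properties
open import Algebra.Properties.Semiring.Sum +-*-semiring as S using (sum)
open import Data.Nat.Tactic.RingSolver using (solve-∀)
open import Data.Product using (∃; ∃₂; _×_; _,_; proj₁; proj₂)
open import Data.Sum using (_⊎_; inj₁; inj₂; [_,_]′)
open import Data.Unit using (⊤; tt)
open import Data.Vec using (Vec; []; _∷_; lookup; tabulate; map; zipWith; replicate)
open import Data.Vec.Properties
  using ( tabulate∘lookup; lookup∘tabulate; tabulate-cong; lookup-zipWith; lookup-map; lookup-replicate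
        ; zipWith-assoc; zipWith-identityʳ; zipWith-identityˡ; zipWith-inverseʳ; zipWith-inverseˡ
        ; map-cong; map-∘; map-id )
open import Function using (_∘_)
open import Function.Bundles using (_↔_; Injection; Inverse; mk↔ₛ′)
open import Function.Properties.Inverse using (↔-refl; ↔-sym; ↔-trans; ↔⇒↣)
open import Level using (0ℓ)
open import Relation.Binary.Definitions using (DecidableEquality)
open import Relation.Binary.PropositionalEquality
  using (_≡_; _≗_; refl; sym; trans; cong; cong₂; subst; subst₂; module ≡-Reasoning)
open import Relation.Nullary using (¬_; Dec; yes; no; does; contradiction)
open import Relation.Nullary.Decidable using (_×-dec_; ¬?; via-injection; decidable-stable; map′)
open import Relation.Unary using (Decidable)

-- The mean of τ over all functionals is h/q = X/q + q^(y-1) w. For 0 < X < λ it lies strictly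
-- between g - (q - 1) q^(y-1) and g, two neighbours in the residue class of τ; this is why the
-- second moment is tested against exactly this gap. Moreover h - q g = -(q - 1) X, so the terms
-- quadratic in w cancel and w survives only as λ w. Put β = (z + y - 1)(q - 1). It is q^r - 1 = (q
-- - 1)(k + z - 1) less q - 1 for each of the k - y descent steps. With w = β - X the inequality
-- becomes X² - (2λ - 1) X + λβ ≥ 0, and the smaller root of this quadratic is the expression under
-- the ceiling. The descent stops at y because the ceiling guarantees X < q^y and no more; without X
-- < q^e the number w could be negative. The ceiling may itself be a root, so the two inequalities
-- on X need not clash. The case left over has w = 0 and λ ≤ β + 1, and it is excluded by r ≤ y and
-- r < k.

private variable
  A A′ : Set
  Φ Ψ : Set

-- Finite sums

record Finite (A : Set) : Set where
  constructor finite
  field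
    {size} : ℕ
    enum   : A ↔ Fin size

open Finite ⦃...⦄ using (enum)

∣_∣ : (A : Set) → ⦃ Finite A ⦄ → ℕ
∣ A ∣ ⦃ fin ⦄ = Finite.size fin

element : ⦃ _ : Finite A ⦄ → Fin ∣ A ∣ → A
element = Inverse.from enum

index : ⦃ _ : Finite A ⦄ → A → Fin ∣ A ∣
index = Inverse.to enum

element-index : ⦃ _ : Finite A ⦄ (a : A) → element (index a) ≡ a
element-index a = Inverse.strictlyInverseʳ enum a

index-element : ⦃ _ : Finite A ⦄ (i : Fin ∣ A ∣) → index (element {A} i) ≡ i
index-element i = Inverse.strictlyInverseˡ enum i

instance
  Fin-finite : ∀ {n} → Finite (Fin n)
  Fin-finite = finite ↔-refl

Vec-finite : ⦃ _ : Finite A ⦄ → ∀ {n} → Finite (Vec A n)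
Vec-finite {A} {n} = finite {size = ∣ A ∣ ^ n} (mk↔ₛ′ to from to∘from from∘to)
  where
  to : Vec A n → Fin (∣ A ∣ ^ n)
  to xs = Fin.funToFin (index ∘ lookup xs)
  from : Fin (∣ A ∣ ^ n) → Vec A n
  from i = tabulate (element ∘ Fin.finToFun i)
  funToFin-cong : ∀ {l m} (f g : Fin l → Fin m) → f ≗ g → Fin.funToFin f ≡ Fin.funToFin g
  funToFin-cong {zero} f g f≗g = refl
  funToFin-cong {suc l} f g f≗g =
    cong₂ Fin.combine (f≗g zero) (funToFin-cong (f ∘ suc) (g ∘ suc) (f≗g ∘ suc))
  to∘from : ∀ i → to (from i) ≡ i
  to∘from i = trans
    (funToFin-cong (index ∘ lookup (from i)) (Fin.finToFun i) λ j → trans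
      (cong (index {A}) (lookup∘tabulate (element ∘ Fin.finToFun i) j))
      (index-element {A} (Fin.finToFun i j)))
    (Finₚ.funToFin-finToFin {n} i)
  from∘to : ∀ xs → from (to xs) ≡ xs
  from∘to xs = trans
    (tabulate-cong λ j → trans
      (cong element (Finₚ.finToFun-funToFin (index ∘ lookup xs) j))
      (element-index _))
    (tabulate∘lookup xs)

opaque
  finite-≟ : ⦃ _ : Finite A ⦄ → DecidableEquality A
  finite-≟ = via-injection (↔⇒↣ enum) Finₚ._≟_

  finite-any? : ⦃ _ : Finite A ⦄ {P : A → Set} → Decidable P → Dec (∃ P)
  finite-any? {P = P} P? = map′
    (λ (i , p) → element i , p)
    (λ (a , p) → index a , subst P (sym (element-index a)) p)
    (Finₚ.any? (P? ∘ element))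

opaque
  ∑ : ⦃ _ : Finite A ⦄ → (A → ℕ) → ℕ
  ∑ f = sum (f ∘ element)

infix 7 ∑
syntax ∑ (λ x → e) = ∑[ x ] e

𝟙 : Dec Φ → ℕ
𝟙 p = if does p then 1 else 0

𝟙-yes : (p? : Dec Φ) → Φ → 𝟙 p? ≡ 1
𝟙-yes (yes _) p = refl
𝟙-yes (no ¬p) p = contradiction p ¬p

𝟙-no : (p? : Dec Φ) → ¬ Φ → 𝟙 p? ≡ 0
𝟙-no (yes p) ¬p = contradiction p ¬p
𝟙-no (no _) ¬p = refl

𝟙-cong : (p? : Dec Φ) (q? : Dec Ψ) → (Φ → Ψ) → (Ψ → Φ) → 𝟙 p? ≡ 𝟙 q?
𝟙-cong (yes p) q? f g = sym (𝟙-yes q? (f p))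
𝟙-cong (no ¬p) q? f g = sym (𝟙-no q? (¬p ∘ g))

𝟙-× : (p? : Dec Φ) (q? : Dec Ψ) → 𝟙 (p? ×-dec q?) ≡ 𝟙 p? * 𝟙 q?
𝟙-× (yes _) (yes _) = refl
𝟙-× (yes _) (no _) = refl
𝟙-× (no _) q? = refl

𝟙-idem : (p? : Dec Φ) → 𝟙 p? * 𝟙 p? ≡ 𝟙 p?
𝟙-idem (yes _) = refl
𝟙-idem (no _) = refl

sum-mono : ∀ {n} {f g : Fin n → ℕ} → (∀ i → f i ≤ g i) → sum f ≤ sum g
sum-mono {zero} f≤g = z≤n
sum-mono {suc n} f≤g = +-mono-≤ (f≤g zero) (sum-mono (f≤g ∘ suc))

term≤sum : ∀ {n} (f : Fin n → ℕ) i → f i ≤ sum f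
term≤sum f zero = m≤m+n _ _
term≤sum f (suc i) = ≤-trans (term≤sum (f ∘ suc) i) (m≤n+m _ _)

sum-const : ∀ n c → sum {n} (λ _ → c) ≡ n * c
sum-const zero c = refl
sum-const (suc n) c = cong (c +_) (sum-const n c)

sum-point : ∀ {n} (f : Fin n → ℕ) i → sum (λ j → 𝟙 (i Finₚ.≟ j) * f j) ≡ f i
sum-point {suc n} f zero = begin
  1 * f zero + sum {n} (λ _ → 0)  ≡⟨ cong₂ _+_ (*-identityˡ (f zero)) (trans (sum-const n 0) (*-zeroʳ n)) ⟩
  f zero + 0                    ≡⟨ +-identityʳ (f zero) ⟩
  f zero                        ∎
  where open ≡-Reasoning
sum-point {suc n} f (suc i) = trans
  (S.sum-cong-≗ {n} λ j → cong (_* f (suc j)) (𝟙-cong (suc i Finₚ.≟ suc j) (i Finₚ.≟ j) Finₚ.suc-injective (cong suc)))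
  (sum-point (f ∘ suc) i)

module _ ⦃ _ : Finite A ⦄ where

  opaque
    unfolding ∑

    ∑-cong : {f g : A → ℕ} → (∀ a → f a ≡ g a) → ∑ f ≡ ∑ g
    ∑-cong f≗g = S.sum-cong-≗ {∣ A ∣} (f≗g ∘ element)

    ∑-mono : {f g : A → ℕ} → (∀ a → f a ≤ g a) → ∑ f ≤ ∑ g
    ∑-mono f≤g = sum-mono (f≤g ∘ element)

    ∑-+ : (f g : A → ℕ) → ∑[ a ] (f a + g a) ≡ ∑ f + ∑ g
    ∑-+ f g = S.∑-distrib-+ {∣ A ∣} (f ∘ element) (g ∘ element)

    ∑-*ˡ : (c : ℕ) (f : A → ℕ) → ∑[ a ] (c * f a) ≡ c * ∑ f
    ∑-*ˡ c f = sym (S.*-distribˡ-sum {∣ A ∣} c (f ∘ element))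

    ∑-*ʳ : (c : ℕ) (f : A → ℕ) → ∑[ a ] (f a * c) ≡ ∑ f * c
    ∑-*ʳ c f = sym (S.*-distribʳ-sum {∣ A ∣} c (f ∘ element))

    ∑-const : (c : ℕ) → ∑ {A} (λ _ → c) ≡ ∣ A ∣ * c
    ∑-const c = sum-const ∣ A ∣ c

    ∑-zero : {f : A → ℕ} → (∀ a → f a ≡ 0) → ∑ f ≡ 0
    ∑-zero f≗0 = trans (∑-cong f≗0) (trans (∑-const 0) (*-zeroʳ ∣ A ∣))

    term≤∑ : (f : A → ℕ) (a : A) → f a ≤ ∑ f
    term≤∑ f a = subst (λ b → f b ≤ ∑ f) (element-index a) (term≤sum (f ∘ element) (index a))

    ∑-permute : (f : A → ℕ) (π : A ↔ A) → ∑[ a ] f (Inverse.to π a) ≡ ∑ f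
    ∑-permute f π = sym (trans
      (S.sum-permute (f ∘ element) (↔-trans (↔-sym enum) (↔-trans π enum)))
      (S.sum-cong-≗ {∣ A ∣} λ i → cong f (element-index _)))

    -- The point is selected by a predicate with a as its only solution, not by `a ≡ b` itself, so
    -- that equations such as `w ⊕ s ⊙ u ≡ 0V` can be used as they stand.
    ∑-point : (f : A → ℕ) (a : A) {E : A → Set} (E? : Decidable E) →
              (∀ {b} → E b → a ≡ b) → E a → ∑[ b ] (𝟙 (E? b) * f b) ≡ f a
    ∑-point f a {E} E? unique Ea = begin
      sum (λ j → 𝟙 (E? (element j)) * f (element j))   ≡⟨ S.sum-cong-≗ {∣ A ∣} (λ j → cong (_* f (element j)) (𝟙-cong (E? (element j)) (index a Finₚ.≟ j) (to j) (from j))) ⟩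
      sum (λ j → 𝟙 (index a Finₚ.≟ j) * f (element j)) ≡⟨ sum-point (f ∘ element) (index a) ⟩
      f (element (index a))                            ≡⟨ cong f (element-index a) ⟩
      f a                                              ∎
      where
      open ≡-Reasoning
      to : (j : Fin ∣ A ∣) → E (element j) → index a ≡ j
      to j e = trans (cong index (unique e)) (index-element {A} j)
      from : (j : Fin ∣ A ∣) → index a ≡ j → E (element j)
      from j refl = subst E (sym (element-index a)) Ea

  ∑-single : (a : A) {E : A → Set} (E? : Decidable E) →
             (∀ {b} → E b → a ≡ b) → E a → ∑[ b ] 𝟙 (E? b) ≡ 1
  ∑-single a E? unique Ea = trans (∑-cong λ b → sym (*-identityʳ (𝟙 (E? b)))) (∑-point (λ _ → 1) a E? unique Ea)

  below-average : (f : A → ℕ) (c : ℕ) → 0 < ∣ A ∣ → ∑ f ≤ ∣ A ∣ * c → ∃ λ a → f a ≤ c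
  below-average f c 0<∣A∣ ∑f≤ with finite-any? (λ a → f a ≤? c)
  ... | yes found = found
  ... | no none = contradiction ∑f≤ (<⇒≱ (<-≤-trans
          (*-monoʳ-< ∣ A ∣ ⦃ >-nonZero 0<∣A∣ ⦄ (n<1+n c))
          (subst (_≤ ∑ f) (∑-const (suc c)) (∑-mono λ a → ≰⇒> λ fa≤c → none (a , fa≤c)))))

opaque
  unfolding ∑

  ∑-comm : ⦃ _ : Finite A ⦄ ⦃ _ : Finite A′ ⦄ (f : A → A′ → ℕ) →
           ∑[ a ] (∑[ b ] f a b) ≡ ∑[ b ] (∑[ a ] f a b)
  ∑-comm {A} {A′} f = S.∑-comm {∣ A ∣} {∣ A′ ∣} (λ i j → f (element i) (element j))

-- Linear algebra over a finite field

module LinearAlgebra {q : ℕ} (K : FiniteField q) where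
  open FiniteField K hiding (card)

  F-ring : CommutativeRing 0ℓ 0ℓ
  F-ring = record { isCommutativeRing = isCommutativeRing }

  open CommutativeRing F-ring public
    using (ring; commutativeSemiring)
    renaming ( +-assoc to +F-assoc; +-identityˡ to +F-identityˡ
             ; +-identityʳ to +F-identityʳ; -‿inverseˡ to +F-inverseˡ; -‿inverseʳ to +F-inverseʳ
             ; *-assoc to *F-assoc; *-comm to *F-comm; *-identityˡ to *F-identityˡ
             ; *-identityʳ to *F-identityʳ; zeroˡ to *F-zeroˡ; zeroʳ to *F-zeroʳ )
  open import Algebra.Properties.Ring ring
    public
    using (-‿distribˡ-*; +-identityˡ-unique; +-inverseʳ-unique; -‿involutive; -0#≈0#)
  open import Algebra.Solver.Ring.NaturalCoefficients.Default commutativeSemiring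
    using (solve; _:+_; _:*_; _:=_)

  instance
    F-finite : Finite F
    F-finite = finite (FiniteField.card K)

  infix 4 _≟F_ _≟V_
  _≟F_ : DecidableEquality F
  _≟F_ = finite-≟

  -- In contrast to functions `Fin n → F`, these vectors are equal as soon as their entries are,
  -- without function extensionality, and can be enumerated.
  V : ℕ → Set
  V = Vec F

  instance
    V-finite : ∀ {n} → Finite (V n)
    V-finite = Vec-finite

  _≟V_ : ∀ {n} → DecidableEquality (V n)
  _≟V_ = finite-≟

  *F-cancel-inv : ∀ {x} (nz : ¬ x ≡ 0F) y → inv x nz *F (x *F y) ≡ y
  *F-cancel-inv {x} nz y = begin
    inv x nz *F (x *F y)  ≡⟨ *F-assoc _ _ _ ⟨
    (inv x nz *F x) *F y  ≡⟨ cong (_*F y) (trans (*F-comm _ _) (inv-* x nz)) ⟩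
    1F *F y               ≡⟨ *F-identityˡ y ⟩
    y                     ∎
    where open ≡-Reasoning

  infixl 6 _⊕_
  infixr 7 _⊙_

  0V : ∀ {n} → V n
  0V = replicate _ 0F

  _⊕_ : ∀ {n} → V n → V n → V n
  _⊕_ = zipWith _+F_

  _⊙_ : ∀ {n} → F → V n → V n
  s ⊙ u = map (s *F_) u

  ⊖_ : ∀ {n} → V n → V n
  ⊖_ = map -F_

  vec-ext : ∀ {n} {u w : V n} → (∀ i → lookup u i ≡ lookup w i) → u ≡ w
  vec-ext {u = u} {w} eq = trans (sym (tabulate∘lookup u)) (trans (tabulate-cong eq) (tabulate∘lookup w))

  lookup-0V : ∀ {n} (i : Fin n) → lookup 0V i ≡ 0F
  lookup-0V i = lookup-replicate i 0F

  ⊕-cancelʳ : ∀ {n} (u w : V n) → (u ⊕ w) ⊕ (⊖ w) ≡ u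
  ⊕-cancelʳ u w = trans (zipWith-assoc +F-assoc u w (⊖ w))
    (trans (cong (u ⊕_) (zipWith-inverseʳ +F-inverseʳ w)) (zipWith-identityʳ +F-identityʳ u))

  ⊕-cancelʳ′ : ∀ {n} (u w : V n) → (u ⊕ (⊖ w)) ⊕ w ≡ u
  ⊕-cancelʳ′ u w = trans (zipWith-assoc +F-assoc u (⊖ w) w)
    (trans (cong (u ⊕_) (zipWith-inverseˡ +F-inverseˡ w)) (zipWith-identityʳ +F-identityʳ u))

  ⊕-inverseˡ : ∀ {n} (u : V n) → (⊖ u) ⊕ u ≡ 0V
  ⊕-inverseˡ = zipWith-inverseˡ +F-inverseˡ

  translation : ∀ {n} → V n → V n ↔ V n
  translation w = mk↔ₛ′ (_⊕ w) (_⊕ (⊖ w)) (λ u → ⊕-cancelʳ′ u w) (λ u → ⊕-cancelʳ u w)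

  ⊙-zero : ∀ {n} (u : V n) → 0F ⊙ u ≡ 0V
  ⊙-zero [] = refl
  ⊙-zero (x ∷ u) = cong₂ _∷_ (*F-zeroˡ x) (⊙-zero u)

  ⊙-0V : ∀ {n} s → s ⊙ 0V {n} ≡ 0V
  ⊙-0V {zero} s = refl
  ⊙-0V {suc n} s = cong₂ _∷_ (*F-zeroʳ s) (⊙-0V s)

  ⊙-cancel : ∀ {n} {s} (nz : ¬ s ≡ 0F) (u : V n) → inv s nz ⊙ (s ⊙ u) ≡ u
  ⊙-cancel nz u = trans (sym (map-∘ _ _ u)) (trans (map-cong (*F-cancel-inv nz) u) (map-id u))

  -1⊙ : ∀ {n} (u : V n) → (-F 1F) ⊙ u ≡ ⊖ u
  -1⊙ u = map-cong (λ x → trans (sym (-‿distribˡ-* 1F x)) (cong -F_ (*F-identityˡ x))) u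

  neg⊙ : ∀ {n} s (u : V n) → ⊖ (s ⊙ u) ≡ (-F s) ⊙ u
  neg⊙ s u = trans (sym (map-∘ _ _ u)) (map-cong (λ x → -‿distribˡ-* s x) u)

  ⊕-inverse-unique : ∀ {n} (u w : V n) → w ⊕ u ≡ 0V → ⊖ u ≡ w
  ⊕-inverse-unique u w eq = trans (sym (zipWith-identityˡ +F-identityˡ (⊖ u)))
    (trans (cong (_⊕ (⊖ u)) (sym eq)) (⊕-cancelʳ w u))

  -- Linear functionals and the dot product

  record IsLinear {n} (φ : V n → F) : Set where
    field
      φ-⊕ : ∀ u w → φ (u ⊕ w) ≡ φ u +F φ w
      φ-⊙ : ∀ s u → φ (s ⊙ u) ≡ s *F φ u

    φ-0 : φ 0V ≡ 0F
    φ-0 = trans (cong φ (sym (⊙-zero 0V))) (trans (φ-⊙ 0F 0V) (*F-zeroˡ _))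

  infix 8 _∙_
  _∙_ : ∀ {n} → V n → V n → F
  [] ∙ [] = 0F
  (x ∷ u) ∙ (y ∷ w) = (x *F y) +F (u ∙ w)

  ∙-linearʳ : ∀ {n} (f : V n) → IsLinear (f ∙_)
  ∙-linearʳ f = record { φ-⊕ = add f ; φ-⊙ = scale f }
    where
    add : ∀ {n} (f u w : V n) → f ∙ (u ⊕ w) ≡ (f ∙ u) +F (f ∙ w)
    add [] [] [] = sym (+F-identityˡ 0F)
    add (x ∷ f) (y ∷ u) (z ∷ w) rewrite add f u w =
      solve 5 (λ x y z a b → x :* (y :+ z) :+ (a :+ b) := (x :* y :+ a) :+ (x :* z :+ b)) refl x y z (f ∙ u) (f ∙ w)
    scale : ∀ {n} (f : V n) s u → f ∙ (s ⊙ u) ≡ s *F (f ∙ u)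
    scale [] s [] = sym (*F-zeroʳ s)
    scale (x ∷ f) s (y ∷ u) rewrite scale f s u =
      solve 4 (λ x y s a → x :* (s :* y) :+ s :* a := s :* (x :* y :+ a)) refl x y s (f ∙ u)

  ∙-comm : ∀ {n} (u w : V n) → u ∙ w ≡ w ∙ u
  ∙-comm [] [] = refl
  ∙-comm (x ∷ u) (y ∷ w) = cong₂ _+F_ (*F-comm x y) (∙-comm u w)

  IsLinear-cong : ∀ {n} {φ ψ : V n → F} → φ ≗ ψ → IsLinear φ → IsLinear ψ
  IsLinear-cong φ≗ψ lin = record
    { φ-⊕ = λ u w → trans (sym (φ≗ψ _)) (trans (φ-⊕ u w) (cong₂ _+F_ (φ≗ψ u) (φ≗ψ w)))
    ; φ-⊙ = λ s u → trans (sym (φ≗ψ _)) (trans (φ-⊙ s u) (cong (s *F_) (φ≗ψ u))) }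
    where open IsLinear lin

  ∙-linearˡ : ∀ {n} (u : V n) → IsLinear (_∙ u)
  ∙-linearˡ u = IsLinear-cong (∙-comm u) (∙-linearʳ u)

  ∙-nondegenerate : ∀ {n} (u : V n) → ¬ u ≡ 0V → ∃ λ f → ¬ f ∙ u ≡ 0F
  ∙-nondegenerate [] u≢0 = contradiction refl u≢0
  ∙-nondegenerate (x ∷ u) u≢0 with x ≟F 0F
  ... | no x≢0 = (1F ∷ 0V) , λ eq → x≢0 (trans (sym (trans
          (cong₂ _+F_ (*F-identityˡ x) (IsLinear.φ-0 (∙-linearˡ u))) (+F-identityʳ x))) eq)
  ... | yes refl with ∙-nondegenerate u (u≢0 ∘ cong (0F ∷_))
  ...   | f , f∙u≢0 = (0F ∷ f) , λ eq → f∙u≢0 (trans (sym (trans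
          (cong (_+F (f ∙ u)) (*F-zeroˡ 0F)) (+F-identityˡ _))) eq)

  -- Subspaces, their orders and hyperplane sections

  record Subspace (n : ℕ) : Set₁ where
    field
      mem   : V n → Set
      mem?  : Decidable mem
      mem-0 : mem 0V
      mem-⊕ : ∀ {u w} → mem u → mem w → mem (u ⊕ w)
      mem-⊙ : ∀ s {u} → mem u → mem (s ⊙ u)

    ι : V n → ℕ
    ι u = 𝟙 (mem? u)

  open Subspace public using (mem; mem?; ι)

  order : ∀ {n} → Subspace n → ℕ
  order U = ∑ (ι U)

  full : ∀ {n} → Subspace n
  full = record
    { mem = λ _ → ⊤ ; mem? = λ _ → yes tt ; mem-0 = tt ; mem-⊕ = λ _ _ → tt ; mem-⊙ = λ _ _ → tt }

  order-full : ∀ n → order (full {n}) ≡ q ^ n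
  order-full n = trans (∑-const {V n} 1) (*-identityʳ _)

  infixl 5 _∩ker_
  _∩ker_ : ∀ {n} (U : Subspace n) {φ : V n → F} → IsLinear φ → Subspace n
  _∩ker_ U {φ} lin = record
    { mem = λ u → mem U u × φ u ≡ 0F
    ; mem? = λ u → mem? U u ×-dec (φ u ≟F 0F)
    ; mem-0 = mem-0 , φ-0
    ; mem-⊕ = λ (Uu , φu) (Uw , φw) → mem-⊕ Uu Uw ,
        trans (φ-⊕ _ _) (trans (cong₂ _+F_ φu φw) (+F-identityˡ 0F))
    ; mem-⊙ = λ s (Uu , φu) → mem-⊙ s Uu , trans (φ-⊙ s _) (trans (cong (s *F_) φu) (*F-zeroʳ s)) }
    where
    open Subspace U using (mem-0; mem-⊕; mem-⊙)
    open IsLinear lin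

  ι-∩ker : ∀ {n} (U : Subspace n) {φ : V n → F} (lin : IsLinear φ) u →
           ι (U ∩ker lin) u ≡ ι U u * 𝟙 (φ u ≟F 0F)
  ι-∩ker U {φ} lin u = 𝟙-× (mem? U u) (φ u ≟F 0F)

  -- The fibres of φ on U are translates of the kernel by the multiples of a vector a with φ a = 1.
  order-∩ker-proper : ∀ {n} (U : Subspace n) {φ : V n → F} (lin : IsLinear φ) {a} →
                      mem U a → ¬ φ a ≡ 0F → order U ≡ q * order (U ∩ker lin)
  order-∩ker-proper U {φ} lin {a′} Ua′ φa′≢0 = begin
    ∑[ u ] ι U u                                        ≡⟨ ∑-cong (λ u → sym (fibres u)) ⟩
    ∑[ u ] (∑[ s ] (ι U u * 𝟙 (φ u ≟F s)))              ≡⟨ ∑-comm (λ u s → ι U u * 𝟙 (φ u ≟F s)) ⟩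
    ∑[ s ] (∑[ u ] (ι U u * 𝟙 (φ u ≟F s)))              ≡⟨ ∑-cong (λ s → sym (∑-permute (λ u → ι U u * 𝟙 (φ u ≟F s)) (translation (s ⊙ a)))) ⟩
    ∑[ s ] (∑[ u ] (ι U (u ⊕ s ⊙ a) * 𝟙 (φ (u ⊕ s ⊙ a) ≟F s))) ≡⟨ ∑-cong (λ s → ∑-cong (shift s)) ⟩
    ∑[ s ] (∑[ u ] ι (U ∩ker lin) u)                    ≡⟨ ∑-const {F} (order (U ∩ker lin)) ⟩
    q * order (U ∩ker lin)                              ∎
    where
    open ≡-Reasoning
    open Subspace U using (mem-⊕; mem-⊙)
    open IsLinear lin
    a : V _
    a = inv (φ a′) φa′≢0 ⊙ a′
    Ua : mem U a
    Ua = mem-⊙ _ Ua′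
    φa : φ a ≡ 1F
    φa = trans (φ-⊙ _ a′) (trans (*F-comm _ _) (inv-* (φ a′) φa′≢0))
    φ-shift : ∀ s u → φ (u ⊕ s ⊙ a) ≡ φ u +F s
    φ-shift s u = trans (φ-⊕ u (s ⊙ a)) (cong (φ u +F_)
      (trans (φ-⊙ s a) (trans (cong (s *F_) φa) (*F-identityʳ s))))
    fibres : ∀ u → ∑[ s ] (ι U u * 𝟙 (φ u ≟F s)) ≡ ι U u
    fibres u = trans (∑-*ˡ (ι U u) (λ s → 𝟙 (φ u ≟F s)))
      (trans (cong (ι U u *_) (∑-single (φ u) (φ u ≟F_) (λ e → e) refl)) (*-identityʳ _))
    back : ∀ s u → (u ⊕ s ⊙ a) ⊕ ((-F s) ⊙ a) ≡ u
    back s u = trans (cong ((u ⊕ s ⊙ a) ⊕_) (sym (neg⊙ s a))) (⊕-cancelʳ u (s ⊙ a))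
    shift : ∀ s u → ι U (u ⊕ s ⊙ a) * 𝟙 (φ (u ⊕ s ⊙ a) ≟F s) ≡ ι (U ∩ker lin) u
    shift s u = trans (cong₂ _*_
        (𝟙-cong (mem? U (u ⊕ s ⊙ a)) (mem? U u)
          (λ m → subst (mem U) (back s u) (mem-⊕ m (mem-⊙ (-F s) Ua)))
          (λ m → mem-⊕ m (mem-⊙ s Ua)))
        (𝟙-cong (φ (u ⊕ s ⊙ a) ≟F s) (φ u ≟F 0F)
          (λ e → +-identityˡ-unique _ s (trans (sym (φ-shift s u)) e))
          (λ e → trans (φ-shift s u) (trans (cong (_+F s) e) (+F-identityˡ s)))))
      (sym (ι-∩ker U lin u))

  order-∩ker : ∀ {n} (U : Subspace n) {φ : V n → F} (lin : IsLinear φ) →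
               order U ≡ order (U ∩ker lin) ⊎ order U ≡ q * order (U ∩ker lin)
  order-∩ker U {φ} lin with finite-any? (λ u → mem? U u ×-dec ¬? (φ u ≟F 0F))
  ... | yes (a , Ua , φa≢0) = inj₂ (order-∩ker-proper U lin Ua φa≢0)
  ... | no none = inj₁ (∑-cong λ u → 𝟙-cong (mem? U u) (mem? (U ∩ker lin) u)
          (λ Uu → Uu , decidable-stable (φ u ≟F 0F) (λ φu≢0 → none (u , Uu , φu≢0)))
          proj₁)

  -- The roles of f and u are exchanged: a nonzero u is a nonzero functional `_∙ u` on the space of
  -- all f, and its kernel is a hyperplane there.
  order-annihilator : ∀ {n} (u : V n) → ¬ u ≡ 0V → q * (∑[ f ] 𝟙 (f ∙ u ≟F 0F)) ≡ q ^ n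
  order-annihilator {n} u u≢0 with ∙-nondegenerate u u≢0
  ... | f , f∙u≢0 = sym (trans (sym (order-full n)) (order-∩ker-proper full (∙-linearˡ u) {f} _ f∙u≢0))

  -- Spans of bases and coordinates

  lincomb-+ : ∀ {k v} (b : Fin k → Fin v → F) {c d e : Fin k → F} → (∀ i → e i ≡ c i +F d i) → ∀ j →
              lincomb K e b j ≡ lincomb K c b j +F lincomb K d b j
  lincomb-+ {zero} b eq j = sym (+F-identityˡ 0F)
  lincomb-+ {suc k} b {c} {d} eq j = trans
    (cong₂ _+F_ (cong (_*F b zero j) (eq zero)) (lincomb-+ (b ∘ suc) (eq ∘ suc) j))
    (solve 5 (λ x y z a b → (x :+ y) :* z :+ (a :+ b) := (x :* z :+ a) :+ (y :* z :+ b)) refl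
      (c zero) (d zero) (b zero j) _ _)

  lincomb-* : ∀ {k v} (b : Fin k → Fin v → F) s {c e : Fin k → F} → (∀ i → e i ≡ s *F c i) → ∀ j →
              lincomb K e b j ≡ s *F lincomb K c b j
  lincomb-* {zero} b s eq j = sym (*F-zeroʳ s)
  lincomb-* {suc k} b s {c} eq j = trans
    (cong₂ _+F_ (cong (_*F b zero j) (eq zero)) (lincomb-* (b ∘ suc) s (eq ∘ suc) j))
    (solve 4 (λ x y z a → (x :* y) :* z :+ x :* a := x :* (y :* z :+ a)) refl
      s (c zero) (b zero j) _)

  span : ∀ {k v} → (Fin k → Fin v → F) → V k → V v
  span b c = tabulate (lincomb K (lookup c) b)

  lookup-span : ∀ {k v} (b : Fin k → Fin v → F) c j → lookup (span b c) j ≡ lincomb K (lookup c) b j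
  lookup-span b c = lookup∘tabulate (lincomb K (lookup c) b)

  span-⊕ : ∀ {k v} (b : Fin k → Fin v → F) c d → span b (c ⊕ d) ≡ span b c ⊕ span b d
  span-⊕ b c d = vec-ext λ j → begin
    lookup (span b (c ⊕ d)) j                        ≡⟨ lookup-span b (c ⊕ d) j ⟩
    lincomb K (lookup (c ⊕ d)) b j                   ≡⟨ lincomb-+ b (λ i → lookup-zipWith _+F_ i c d) j ⟩
    lincomb K (lookup c) b j +F lincomb K (lookup d) b j ≡⟨ cong₂ _+F_ (lookup-span b c j) (lookup-span b d j) ⟨
    lookup (span b c) j +F lookup (span b d) j       ≡⟨ lookup-zipWith _+F_ j (span b c) (span b d) ⟨
    lookup (span b c ⊕ span b d) j                   ∎
    where open ≡-Reasoning

  span-⊙ : ∀ {k v} (b : Fin k → Fin v → F) s c → span b (s ⊙ c) ≡ s ⊙ span b c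
  span-⊙ b s c = vec-ext λ j → begin
    lookup (span b (s ⊙ c)) j          ≡⟨ lookup-span b (s ⊙ c) j ⟩
    lincomb K (lookup (s ⊙ c)) b j     ≡⟨ lincomb-* b s (λ i → lookup-map i (s *F_) c) j ⟩
    s *F lincomb K (lookup c) b j      ≡⟨ cong (s *F_) (lookup-span b c j) ⟨
    s *F lookup (span b c) j           ≡⟨ lookup-map j (s *F_) (span b c) ⟨
    lookup (s ⊙ span b c) j            ∎
    where open ≡-Reasoning

  span-0 : ∀ {k v} (b : Fin k → Fin v → F) → span b 0V ≡ 0V
  span-0 b = trans (cong (span b) (sym (⊙-zero 0V))) (trans (span-⊙ b 0F 0V) (⊙-zero _))

  span-injective : ∀ {k v} {b : Fin k → Fin v → F} → LinIndep K b → ∀ {c d} → span b c ≡ span b d → c ≡ d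
  span-injective {k} {v} {b} indep {c} {d} eq = trans (sym (⊕-cancelʳ′ c d))
    (trans (cong (_⊕ d) c-d≡0) (zipWith-identityˡ +F-identityˡ d))
    where
    c-d≡0 : c ⊕ (⊖ d) ≡ 0V
    c-d≡0 = vec-ext λ i → trans (indep (lookup (c ⊕ (⊖ d))) (λ j → begin
      lincomb K (lookup (c ⊕ (⊖ d))) b j           ≡⟨ lookup-span b (c ⊕ (⊖ d)) j ⟨
      lookup (span b (c ⊕ (⊖ d))) j                ≡⟨ cong (λ w → lookup w j) (span-⊕ b c (⊖ d)) ⟩
      lookup (span b c ⊕ span b (⊖ d)) j           ≡⟨ cong (λ w → lookup (span b c ⊕ span b w) j) (sym (-1⊙ d)) ⟩
      lookup (span b c ⊕ span b ((-F 1F) ⊙ d)) j   ≡⟨ cong (λ w → lookup (span b c ⊕ w) j) (trans (span-⊙ b _ d) (-1⊙ _)) ⟩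
      lookup (span b c ⊕ (⊖ span b d)) j           ≡⟨ cong (λ w → lookup (w ⊕ (⊖ span b d)) j) eq ⟩
      lookup (span b d ⊕ (⊖ span b d)) j           ≡⟨ cong (λ w → lookup w j) (zipWith-inverseʳ +F-inverseʳ (span b d)) ⟩
      lookup 0V j                                  ≡⟨ lookup-0V j ⟩
      0F                                           ∎) i) (sym (lookup-0V i))
      where open ≡-Reasoning

  -- For independent b this is the intersection of U with the span of b, seen in coordinates.
  -- Cutting U by a functional cuts the pullback by the composed functional, so intersections with
  -- spread members obey the same dimension count as U.
  pullback : ∀ {k v} → (Fin k → Fin v → F) → Subspace v → Subspace k
  pullback b U = record
    { mem = mem U ∘ span b
    ; mem? = mem? U ∘ span b
    ; mem-0 = subst (mem U) (sym (span-0 b)) mem-0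
    ; mem-⊕ = λ {c} {d} m n → subst (mem U) (sym (span-⊕ b c d)) (mem-⊕ m n)
    ; mem-⊙ = λ s {c} m → subst (mem U) (sym (span-⊙ b s c)) (mem-⊙ s m) }
    where open Subspace U using (mem-0; mem-⊕; mem-⊙)

  span-linear : ∀ {k v} (b : Fin k → Fin v → F) {φ : V v → F} → IsLinear φ → IsLinear (φ ∘ span b)
  span-linear b {φ} lin = record
    { φ-⊕ = λ c d → trans (cong φ (span-⊕ b c d)) (φ-⊕ _ _)
    ; φ-⊙ = λ s c → trans (cong φ (span-⊙ b s c)) (φ-⊙ s _) }
    where open IsLinear lin

-- Moments of the hyperplane sections of a projective set

module Moments {m : ℕ} (K : FiniteField (suc m)) where
  open FiniteField K using (F; _+F_; _*F_; -F_; 0F; inv)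
  open LinearAlgebra K

  private
    q : ℕ
    q = suc m

  annihilator : ∀ {n} → V n → ℕ
  annihilator u = ∑[ f ] 𝟙 (f ∙ u ≟F 0F)

  q*annihilator : ∀ {n} (u : V n) → q * annihilator u ≡ q ^ n + 𝟙 (u ≟V 0V) * (m * q ^ n)
  q*annihilator {n} u with u ≟V 0V
  ... | no u≢0 = trans (order-annihilator u u≢0) (sym (+-identityʳ _))
  ... | yes refl = trans
          (cong (q *_) (trans (∑-cong {A = V n} λ f → 𝟙-yes (f ∙ 0V ≟F 0F) (IsLinear.φ-0 (∙-linearʳ f))) (order-full n)))
          (cong (q ^ n +_) (sym (+-identityʳ _)))

  -- There is one root s if b ≠ 0, and there are q or no roots if b = 0, according to whether a = 0.
  -- The extra indicator on the left merges these cases into one formula, which can then be summed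
  -- over functionals with a = f ∙ w and b = f ∙ u.
  line-count : ∀ a b → ∑[ s ] 𝟙 (a +F (s *F b) ≟F 0F) + 𝟙 (b ≟F 0F) ≡ 1 + q * (𝟙 (b ≟F 0F) * 𝟙 (a ≟F 0F))
  line-count a b with b ≟F 0F
  ... | yes refl = begin
    ∑[ s ] 𝟙 (a +F (s *F 0F) ≟F 0F) + 1
      ≡⟨ cong (_+ 1) (∑-cong λ s → cong (λ x → 𝟙 (x ≟F 0F)) (trans (cong (a +F_) (*F-zeroʳ s)) (+F-identityʳ a))) ⟩
    ∑ {F} (λ _ → 𝟙 (a ≟F 0F)) + 1
      ≡⟨ cong (_+ 1) (∑-const {F} (𝟙 (a ≟F 0F))) ⟩
    q * 𝟙 (a ≟F 0F) + 1
      ≡⟨ +-comm _ 1 ⟩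
    1 + q * 𝟙 (a ≟F 0F)
      ≡⟨ cong (λ x → 1 + q * x) (sym (*-identityˡ _)) ⟩
    1 + q * (1 * 𝟙 (a ≟F 0F)) ∎
    where open ≡-Reasoning
  ... | no b≢0 = begin
    ∑[ s ] 𝟙 (a +F (s *F b) ≟F 0F) + 0  ≡⟨ +-identityʳ _ ⟩
    ∑[ s ] 𝟙 (a +F (s *F b) ≟F 0F)      ≡⟨ ∑-single (inv b b≢0 *F (-F a)) (λ s → a +F (s *F b) ≟F 0F) unique root ⟩
    1                                 ≡⟨ cong suc (*-zeroʳ q) ⟨
    1 + q * 0                         ∎
    where
    open ≡-Reasoning
    unique : ∀ {s} → a +F (s *F b) ≡ 0F → inv b b≢0 *F (-F a) ≡ s
    unique {s} eq = trans (cong (inv b b≢0 *F_) (trans (sym (+-inverseʳ-unique a _ eq)) (*F-comm s b)))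
      (*F-cancel-inv b≢0 s)
    root : a +F ((inv b b≢0 *F (-F a)) *F b) ≡ 0F
    root = trans (cong (a +F_) (trans (*F-assoc _ _ b) (trans (cong (inv b b≢0 *F_) (*F-comm _ b)) (*F-cancel-inv b≢0 (-F a)))))
      (+F-inverseʳ a)

  joint : ∀ {n} → V n → V n → ℕ
  joint u w = ∑[ f ] (𝟙 (f ∙ u ≟F 0F) * 𝟙 (f ∙ w ≟F 0F))

  -- For u ≠ 0 this is 0 or 1, the indicator of w lying on the line through u. As a sum over s it
  -- matches the terms in which w + s u vanishes.
  collinear : ∀ {n} → V n → V n → ℕ
  collinear u w = ∑[ s ] 𝟙 (w ⊕ s ⊙ u ≟V 0V)

  -- For fixed u ≠ 0, the functionals vanishing at u and w are counted through those
  -- vanishing at w + s u for the various scalars s.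
  q²*joint : ∀ {n} (u w : V n) → ¬ u ≡ 0V → q * q * joint u w ≡ q ^ n + m * q ^ n * collinear u w
  q²*joint {n} u w u≢0 = +-cancelˡ-≡ (q * W) _ _ (begin
    q * W + q * q * joint u w
      ≡⟨ factor q W (joint u w) ⟩
    q * (W + q * joint u w)
      ≡⟨ cong (q *_) sum-over-functionals ⟨
    q * (∑[ s ] annihilator (w ⊕ s ⊙ u) + annihilator u)
      ≡⟨ *-distribˡ-+ q (∑[ s ] annihilator (w ⊕ s ⊙ u)) (annihilator u) ⟩
    q * (∑[ s ] annihilator (w ⊕ s ⊙ u)) + q * annihilator u
      ≡⟨ cong₂ _+_ (sym (∑-*ˡ q (λ s → annihilator (w ⊕ s ⊙ u)))) (order-annihilator u u≢0) ⟩
    ∑[ s ] (q * annihilator (w ⊕ s ⊙ u)) + W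
      ≡⟨ cong (_+ W) (∑-cong λ s → q*annihilator (w ⊕ s ⊙ u)) ⟩
    ∑[ s ] (W + 𝟙 (w ⊕ s ⊙ u ≟V 0V) * (m * W)) + W
      ≡⟨ cong (_+ W) (trans (∑-+ (λ _ → W) (λ s → 𝟙 (w ⊕ s ⊙ u ≟V 0V) * (m * W)))
           (cong₂ _+_ (∑-const {F} W) (∑-*ʳ (m * W) (λ s → 𝟙 (w ⊕ s ⊙ u ≟V 0V))))) ⟩
    q * W + collinear u w * (m * W) + W
      ≡⟨ regroup (q * W) (collinear u w) (m * W) W ⟩
    q * W + (W + m * W * collinear u w) ∎)
    where
    open ≡-Reasoning
    W : ℕ
    W = q ^ n
    factor : ∀ q W j → q * W + q * q * j ≡ q * (W + q * j)
    factor = solve-∀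
    regroup : ∀ a c b W → a + c * b + W ≡ a + (W + b * c)
    regroup = solve-∀
    per-functional : ∀ f → ∑[ s ] 𝟙 (f ∙ (w ⊕ s ⊙ u) ≟F 0F) + 𝟙 (f ∙ u ≟F 0F)
                         ≡ 1 + q * (𝟙 (f ∙ u ≟F 0F) * 𝟙 (f ∙ w ≟F 0F))
    per-functional f = trans
      (cong (_+ 𝟙 (f ∙ u ≟F 0F)) (∑-cong λ s → cong (λ x → 𝟙 (x ≟F 0F)) (trans (φ-⊕ w (s ⊙ u)) (cong ((f ∙ w) +F_) (φ-⊙ s u)))))
      (line-count (f ∙ w) (f ∙ u))
      where open IsLinear (∙-linearʳ f)
    sum-over-functionals : ∑[ s ] annihilator (w ⊕ s ⊙ u) + annihilator u ≡ W + q * joint u w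
    sum-over-functionals = begin
      ∑[ s ] annihilator (w ⊕ s ⊙ u) + annihilator u
        ≡⟨ cong (_+ annihilator u) (∑-comm (λ s f → 𝟙 (f ∙ (w ⊕ s ⊙ u) ≟F 0F))) ⟩
      ∑[ f ] (∑[ s ] 𝟙 (f ∙ (w ⊕ s ⊙ u) ≟F 0F)) + annihilator u
        ≡⟨ ∑-+ (λ f → ∑[ s ] 𝟙 (f ∙ (w ⊕ s ⊙ u) ≟F 0F)) (λ f → 𝟙 (f ∙ u ≟F 0F)) ⟨
      ∑[ f ] (∑[ s ] 𝟙 (f ∙ (w ⊕ s ⊙ u) ≟F 0F) + 𝟙 (f ∙ u ≟F 0F))
        ≡⟨ ∑-cong per-functional ⟩
      ∑[ f ] (1 + q * (𝟙 (f ∙ u ≟F 0F) * 𝟙 (f ∙ w ≟F 0F)))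
        ≡⟨ ∑-+ (λ _ → 1) (λ f → q * (𝟙 (f ∙ u ≟F 0F) * 𝟙 (f ∙ w ≟F 0F))) ⟩
      ∑ {V n} (λ _ → 1) + ∑[ f ] (q * (𝟙 (f ∙ u ≟F 0F) * 𝟙 (f ∙ w ≟F 0F)))
        ≡⟨ cong₂ _+_ (order-full n) (∑-*ˡ q (λ f → 𝟙 (f ∙ u ≟F 0F) * 𝟙 (f ∙ w ≟F 0F))) ⟩
      W + q * joint u w ∎

  -- The indicator function of a union of lines through 0, with 0 removed.
  record IsProjectiveSet {n} (g : V n → ℕ) : Set where
    field
      g-0    : g 0V ≡ 0
      g-⊙    : ∀ {s} → ¬ s ≡ 0F → ∀ u → g (s ⊙ u) ≡ g u
      g-idem : ∀ u → g u * g u ≡ g u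

  module _ {n} {g : V n → ℕ} (projective : IsProjectiveSet g) where
    open IsProjectiveSet projective

    private
      W : ℕ
      W = q ^ n

    section : V n → ℕ
    section f = ∑[ u ] (g u * 𝟙 (f ∙ u ≟F 0F))

    section-0 : section 0V ≡ ∑ g
    section-0 = ∑-cong λ u → trans
      (cong (g u *_) (𝟙-yes (0V ∙ u ≟F 0F) (IsLinear.φ-0 (∙-linearˡ u)))) (*-identityʳ (g u))

    -- The weight g vanishes at 0, so counts valid only for nonzero vectors may be substituted under
    -- the sum.
    away-from-0 : {a b : V n → ℕ} → (∀ u → ¬ u ≡ 0V → a u ≡ b u) →
                  ∑[ u ] (g u * a u) ≡ ∑[ u ] (g u * b u)
    away-from-0 {a} {b} eq = ∑-cong pointwise
      where
      pointwise : ∀ u → g u * a u ≡ g u * b u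
      pointwise u with u ≟V 0V
      ... | yes refl = trans (cong (_* a 0V) g-0) (sym (cong (_* b 0V) g-0))
      ... | no u≢0 = cong (g u *_) (eq u u≢0)

    first-moment : q * (∑[ f ] section f) ≡ W * ∑ g
    first-moment = begin
      q * (∑[ f ] section f)                                ≡⟨ cong (q *_) (∑-comm (λ f u → g u * 𝟙 (f ∙ u ≟F 0F))) ⟩
      q * (∑[ u ] (∑[ f ] (g u * 𝟙 (f ∙ u ≟F 0F))))         ≡⟨ cong (q *_) (∑-cong λ u → ∑-*ˡ (g u) (λ f → 𝟙 (f ∙ u ≟F 0F))) ⟩
      q * (∑[ u ] (g u * annihilator u))                    ≡⟨ ∑-*ˡ q (λ u → g u * annihilator u) ⟨
      ∑[ u ] (q * (g u * annihilator u))                    ≡⟨ ∑-cong (λ u → swap q (g u) (annihilator u)) ⟩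
      ∑[ u ] (g u * (q * annihilator u))                    ≡⟨ away-from-0 order-annihilator ⟩
      ∑[ u ] (g u * W)                                      ≡⟨ ∑-*ʳ W g ⟩
      ∑ g * W                                               ≡⟨ *-comm (∑ g) W ⟩
      W * ∑ g                                               ∎
      where
      open ≡-Reasoning
      swap : ∀ a b c → a * (b * c) ≡ b * (a * c)
      swap = solve-∀

    -- The m nonzero scalars contribute `g u` each and the scalar 0 contributes nothing. Adding
    -- `g u` at s = 0 makes all q terms equal.
    multiples : ∀ u → ∑[ s ] g ((-F s) ⊙ u) ≡ m * g u
    multiples u = +-cancelʳ-≡ (g u) _ _ (begin
      ∑[ s ] g ((-F s) ⊙ u) + g u
        ≡⟨ cong (∑[ s ] g ((-F s) ⊙ u) +_) (∑-point (λ _ → g u) 0F (0F ≟F_) (λ e → e) refl) ⟨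
      ∑[ s ] g ((-F s) ⊙ u) + ∑[ s ] (𝟙 (0F ≟F s) * g u)
        ≡⟨ ∑-+ (λ s → g ((-F s) ⊙ u)) (λ s → 𝟙 (0F ≟F s) * g u) ⟨
      ∑[ s ] (g ((-F s) ⊙ u) + 𝟙 (0F ≟F s) * g u)
        ≡⟨ ∑-cong pointwise ⟩
      ∑ {F} (λ _ → g u)
        ≡⟨ ∑-const {F} (g u) ⟩
      g u + m * g u
        ≡⟨ +-comm (g u) _ ⟩
      m * g u + g u ∎)
      where
      open ≡-Reasoning
      pointwise : ∀ s → g ((-F s) ⊙ u) + 𝟙 (0F ≟F s) * g u ≡ g u
      pointwise s with 0F ≟F s
      ... | yes refl = trans (cong₂ _+_ (trans (cong (λ x → g (x ⊙ u)) -0#≈0#) (trans (cong g (⊙-zero u)) g-0)) (+-identityʳ (g u))) refl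
      ... | no 0≢s = trans (+-identityʳ _) (g-⊙ (λ -s≡0 → 0≢s (sym (trans (sym (-‿involutive s)) (trans (cong -F_ -s≡0) -0#≈0#)))) u)

    collinear-sum : ∀ u → ∑[ w ] (g w * collinear u w) ≡ m * g u
    collinear-sum u = begin
      ∑[ w ] (g w * collinear u w)                            ≡⟨ ∑-cong (λ w → sym (∑-*ˡ (g w) (λ s → 𝟙 (w ⊕ s ⊙ u ≟V 0V)))) ⟩
      ∑[ w ] (∑[ s ] (g w * 𝟙 (w ⊕ s ⊙ u ≟V 0V)))             ≡⟨ ∑-comm (λ w s → g w * 𝟙 (w ⊕ s ⊙ u ≟V 0V)) ⟩
      ∑[ s ] (∑[ w ] (g w * 𝟙 (w ⊕ s ⊙ u ≟V 0V)))             ≡⟨ ∑-cong (λ s → ∑-cong λ w → *-comm (g w) _) ⟩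
      ∑[ s ] (∑[ w ] (𝟙 (w ⊕ s ⊙ u ≟V 0V) * g w))             ≡⟨ ∑-cong (λ s → ∑-point g ((-F s) ⊙ u) (λ w → w ⊕ s ⊙ u ≟V 0V) (unique s) (root s)) ⟩
      ∑[ s ] g ((-F s) ⊙ u)                                   ≡⟨ multiples u ⟩
      m * g u                                                 ∎
      where
      open ≡-Reasoning
      unique : ∀ s {w} → w ⊕ s ⊙ u ≡ 0V → (-F s) ⊙ u ≡ w
      unique s {w} eq = trans (sym (neg⊙ s u)) (⊕-inverse-unique (s ⊙ u) w eq)
      root : ∀ s → (-F s) ⊙ u ⊕ s ⊙ u ≡ 0V
      root s = trans (cong (_⊕ s ⊙ u) (sym (neg⊙ s u))) (⊕-inverseˡ (s ⊙ u))

    -- Ordered pairs of points are counted by the functionals vanishing at both: W / q² of them for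
    -- independent pairs, W / q for collinear ones. Each point is collinear with the m points of its
    -- own line, and their surplus gives the term m² ∑ g.
    second-moment : q * q * (∑[ f ] (section f * section f)) ≡ W * (∑ g * ∑ g + m * m * ∑ g)
    second-moment = begin
      q * q * (∑[ f ] (section f * section f))
        ≡⟨ cong (q * q *_) (trans (∑-cong expand) (trans (∑-comm (λ f u → ∑[ w ] summand f u w)) (∑-cong λ u → ∑-comm (λ f w → summand f u w)))) ⟩
      q * q * (∑[ u ] (∑[ w ] (∑[ f ] summand f u w)))
        ≡⟨ cong (q * q *_) (∑-cong λ u → trans (∑-cong λ w → collect u w) (∑-*ˡ (g u) (λ w → g w * joint u w))) ⟩
      q * q * (∑[ u ] (g u * (∑[ w ] (g w * joint u w))))
        ≡⟨ ∑-*ˡ (q * q) (λ u → g u * (∑[ w ] (g w * joint u w))) ⟨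
      ∑[ u ] (q * q * (g u * (∑[ w ] (g w * joint u w))))
        ≡⟨ ∑-cong (λ u → swap (q * q) (g u) _) ⟩
      ∑[ u ] (g u * (q * q * (∑[ w ] (g w * joint u w))))
        ≡⟨ away-from-0 inner ⟩
      ∑[ u ] (g u * (W * ∑ g + m * W * (m * g u)))
        ≡⟨ ∑-cong (λ u → trans (rearrange (g u) (W * ∑ g) (m * W) m) (cong (λ x → g u * (W * ∑ g) + m * W * m * x) (g-idem u))) ⟩
      ∑[ u ] (g u * (W * ∑ g) + m * W * m * g u)
        ≡⟨ ∑-+ (λ u → g u * (W * ∑ g)) (λ u → m * W * m * g u) ⟩
      ∑[ u ] (g u * (W * ∑ g)) + ∑[ u ] (m * W * m * g u)
        ≡⟨ cong₂ _+_ (∑-*ʳ (W * ∑ g) g) (∑-*ˡ (m * W * m) g) ⟩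
      ∑ g * (W * ∑ g) + m * W * m * ∑ g
        ≡⟨ finish (∑ g) W m ⟩
      W * (∑ g * ∑ g + m * m * ∑ g) ∎
      where
      open ≡-Reasoning
      swap : ∀ a b c → a * (b * c) ≡ b * (a * c)
      swap = solve-∀
      rearrange : ∀ x a b m → x * (a + b * (m * x)) ≡ x * a + b * m * (x * x)
      rearrange = solve-∀
      finish : ∀ h w m → h * (w * h) + m * w * m * h ≡ w * (h * h + m * m * h)
      finish = solve-∀
      summand : V n → V n → V n → ℕ
      summand f u w = g u * 𝟙 (f ∙ u ≟F 0F) * (g w * 𝟙 (f ∙ w ≟F 0F))
      expand : ∀ f → section f * section f ≡ ∑[ u ] (∑[ w ] summand f u w)
      expand f = trans (sym (∑-*ʳ (section f) (λ u → g u * 𝟙 (f ∙ u ≟F 0F))))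
        (∑-cong λ u → sym (∑-*ˡ (g u * 𝟙 (f ∙ u ≟F 0F)) (λ w → g w * 𝟙 (f ∙ w ≟F 0F))))
      shuffle : ∀ a b c d → a * b * (c * d) ≡ a * (c * (b * d))
      shuffle = solve-∀
      collect : ∀ u w → ∑[ f ] summand f u w ≡ g u * (g w * joint u w)
      collect u w = trans (∑-cong λ f → shuffle (g u) (𝟙 (f ∙ u ≟F 0F)) (g w) (𝟙 (f ∙ w ≟F 0F)))
        (trans (∑-*ˡ (g u) (λ f → g w * (𝟙 (f ∙ u ≟F 0F) * 𝟙 (f ∙ w ≟F 0F))))
          (cong (g u *_) (∑-*ˡ (g w) (λ f → 𝟙 (f ∙ u ≟F 0F) * 𝟙 (f ∙ w ≟F 0F)))))
      inner : ∀ u → ¬ u ≡ 0V → q * q * (∑[ w ] (g w * joint u w)) ≡ W * ∑ g + m * W * (m * g u)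
      inner u u≢0 = begin
        q * q * (∑[ w ] (g w * joint u w))
          ≡⟨ ∑-*ˡ (q * q) (λ w → g w * joint u w) ⟨
        ∑[ w ] (q * q * (g w * joint u w))
          ≡⟨ ∑-cong (λ w → trans (swap (q * q) (g w) (joint u w)) (trans (cong (g w *_) (q²*joint u w u≢0)) (spread (g w) W (m * W) (collinear u w)))) ⟩
        ∑[ w ] (W * g w + m * W * (g w * collinear u w))
          ≡⟨ ∑-+ (λ w → W * g w) (λ w → m * W * (g w * collinear u w)) ⟩
        ∑[ w ] (W * g w) + ∑[ w ] (m * W * (g w * collinear u w))
          ≡⟨ cong₂ _+_ (∑-*ˡ W g) (trans (∑-*ˡ (m * W) (λ w → g w * collinear u w)) (cong (m * W *_) (collinear-sum u))) ⟩
        W * ∑ g + m * W * (m * g u) ∎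
        where
        spread : ∀ x a b c → x * (a + b * c) ≡ a * x + b * (x * c)
        spread = solve-∀

-- Holes of a partial spread

module Holes {m : ℕ} (K : FiniteField (suc m)) {v k n : ℕ} (S : PartialSpread K v k n) where
  open FiniteField K using (F; 0F; inv)
  open LinearAlgebra K
  open Moments K
  open PartialSpread S

  private
    q : ℕ
    q = suc m

  Covered : V v → Set
  Covered u = ∃ λ i → ∃ λ c → span (basis i) c ≡ u

  covered? : ∀ u → Dec (Covered u)
  covered? u = finite-any? λ i → finite-any? λ c → span (basis i) c ≟V u

  hole? : ∀ u → Dec (¬ u ≡ 0V × ¬ Covered u)
  hole? u = ¬? (u ≟V 0V) ×-dec ¬? (covered? u)

  η : V v → ℕ
  η u = 𝟙 (hole? u)

  cover-count : V v → ℕ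
  cover-count u = ∑[ i ] (∑[ c ] 𝟙 (span (basis i) c ≟V u))

  span-disjoint : ∀ {i j c d} → span (basis i) c ≡ span (basis j) d → ¬ span (basis i) c ≡ 0V → i ≡ j
  span-disjoint {i} {j} {c} {d} eq nz with i Finₚ.≟ j
  ... | yes i≡j = i≡j
  ... | no i≢j = contradiction
          (vec-ext λ x → trans (lookup-span (basis i) c x) (trans
            (disjoint i j i≢j (lookup c) (lookup d) (λ x → trans (sym (lookup-span (basis i) c x))
              (trans (cong (λ w → lookup w x) eq) (lookup-span (basis j) d x))) x)
            (sym (lookup-0V x))))
          nz

  cover-count-0 : cover-count 0V ≡ n
  cover-count-0 = begin
    ∑[ i ] (∑[ c ] 𝟙 (span (basis i) c ≟V 0V))
      ≡⟨ ∑-cong (λ i → ∑-single 0V (λ c → span (basis i) c ≟V 0V)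
           (λ eq → span-injective (indep i) (trans (span-0 (basis i)) (sym eq))) (span-0 (basis i))) ⟩
    ∑ {Fin n} (λ _ → 1)  ≡⟨ ∑-const {Fin n} 1 ⟩
    n * 1                ≡⟨ *-identityʳ n ⟩
    n                    ∎
    where open ≡-Reasoning

  cover-count-covered : ∀ {u} → ¬ u ≡ 0V → Covered u → cover-count u ≡ 1
  cover-count-covered {u} u≢0 (j , d , eq) = begin
    ∑[ i ] (∑[ c ] 𝟙 (span (basis i) c ≟V u))
      ≡⟨ ∑-cong (λ i → trans (∑-cong (factor i)) (∑-*ˡ (𝟙 (j Finₚ.≟ i)) (λ c → 𝟙 (d ≟V c)))) ⟩
    ∑[ i ] (𝟙 (j Finₚ.≟ i) * (∑[ c ] 𝟙 (d ≟V c)))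
      ≡⟨ ∑-point (λ _ → ∑[ c ] 𝟙 (d ≟V c)) j (j Finₚ.≟_) (λ e → e) refl ⟩
    ∑[ c ] 𝟙 (d ≟V c)
      ≡⟨ ∑-single d (d ≟V_) (λ e → e) refl ⟩
    1 ∎
    where
    open ≡-Reasoning
    factor : ∀ i c → 𝟙 (span (basis i) c ≟V u) ≡ 𝟙 (j Finₚ.≟ i) * 𝟙 (d ≟V c)
    factor i c = trans
      (𝟙-cong (span (basis i) c ≟V u) ((j Finₚ.≟ i) ×-dec (d ≟V c)) to (λ { (refl , refl) → eq }))
      (𝟙-× (j Finₚ.≟ i) (d ≟V c))
      where
      to : span (basis i) c ≡ u → j ≡ i × d ≡ c
      to e with span-disjoint {j} {i} {d} {c} (trans eq (sym e)) (λ z → u≢0 (trans (sym eq) z))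
      ... | refl = refl , span-injective (indep j) (trans eq (sym e))

  cover-count-uncovered : ∀ {u} → ¬ Covered u → cover-count u ≡ 0
  cover-count-uncovered {u} ¬cov = ∑-zero λ i → ∑-zero λ c → 𝟙-no (span (basis i) c ≟V u) λ e → ¬cov (i , c , e)

  -- By disjointness a nonzero vector is either a hole or covered exactly once, while 0 lies in all
  -- n members. The indicators of 0 on both sides absorb this exception.
  partition : ∀ u → cover-count u + η u + 𝟙 (u ≟V 0V) ≡ 1 + 𝟙 (u ≟V 0V) * n
  partition u with u ≟V 0V | covered? u
  ... | yes refl | _ = trans (cong (λ x → x + 0 + 1) cover-count-0) (shape n)
    where
    shape : ∀ n → n + 0 + 1 ≡ 1 + 1 * n
    shape = solve-∀
  ... | no u≢0 | yes cov = cong (λ x → x + 0 + 0) (cover-count-covered u≢0 cov)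
  ... | no u≢0 | no ¬cov = cong (λ x → x + 1 + 0) (cover-count-uncovered ¬cov)

  holes : Subspace v → V v → ℕ
  holes U u = ι U u * η u

  #holes : Subspace v → ℕ
  #holes U = ∑ (holes U)

  -- This is `partition` summed over U. Member i contributes the coefficient vectors that its basis
  -- sends into U, and the terms at 0 leave the 1 and the n.
  order-decomposition : ∀ U → ∑[ i ] order (pullback (basis i) U) + #holes U + 1 ≡ order U + n
  order-decomposition U = begin
    ∑[ i ] order (pullback (basis i) U) + #holes U + 1
      ≡⟨ cong₂ (λ x y → x + #holes U + y) (sym covered-part) (sym (zero-part 1)) ⟩
    ∑[ u ] (ι U u * cover-count u) + #holes U + ∑[ u ] (𝟙 (u ≟V 0V) * (ι U u * 1))
      ≡⟨ cong (_+ _) (∑-+ (λ u → ι U u * cover-count u) (holes U)) ⟨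
    ∑[ u ] (ι U u * cover-count u + holes U u) + ∑[ u ] (𝟙 (u ≟V 0V) * (ι U u * 1))
      ≡⟨ ∑-+ (λ u → ι U u * cover-count u + holes U u) (λ u → 𝟙 (u ≟V 0V) * (ι U u * 1)) ⟨
    ∑[ u ] (ι U u * cover-count u + holes U u + 𝟙 (u ≟V 0V) * (ι U u * 1))
      ≡⟨ ∑-cong (λ u → trans (gather (ι U u) (cover-count u) (η u) (𝟙 (u ≟V 0V)))
           (trans (cong (ι U u *_) (partition u)) (scatter (ι U u) (𝟙 (u ≟V 0V)) n))) ⟩
    ∑[ u ] (ι U u + 𝟙 (u ≟V 0V) * (ι U u * n))
      ≡⟨ ∑-+ (ι U) (λ u → 𝟙 (u ≟V 0V) * (ι U u * n)) ⟩
    order U + ∑[ u ] (𝟙 (u ≟V 0V) * (ι U u * n))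
      ≡⟨ cong (order U +_) (zero-part n) ⟩
    order U + n ∎
    where
    open ≡-Reasoning
    gather : ∀ i c e z → i * c + i * e + z * (i * 1) ≡ i * (c + e + z)
    gather = solve-∀
    scatter : ∀ i z n → i * (1 + z * n) ≡ i + z * (i * n)
    scatter = solve-∀
    zero-part : ∀ c → ∑[ u ] (𝟙 (u ≟V 0V) * (ι U u * c)) ≡ c
    zero-part c = trans (∑-point (λ u → ι U u * c) 0V (_≟V 0V) sym refl)
      (trans (cong (_* c) (𝟙-yes (mem? U 0V) (Subspace.mem-0 U))) (*-identityˡ c))
    covered-part : ∑[ u ] (ι U u * cover-count u) ≡ ∑[ i ] order (pullback (basis i) U)
    covered-part = begin
      ∑[ u ] (ι U u * cover-count u)
        ≡⟨ ∑-cong (λ u → trans (sym (∑-*ˡ (ι U u) (λ i → ∑[ c ] 𝟙 (span (basis i) c ≟V u))))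
             (∑-cong λ i → sym (∑-*ˡ (ι U u) (λ c → 𝟙 (span (basis i) c ≟V u))))) ⟩
      ∑[ u ] (∑[ i ] (∑[ c ] (ι U u * 𝟙 (span (basis i) c ≟V u))))
        ≡⟨ ∑-comm (λ u i → ∑[ c ] (ι U u * 𝟙 (span (basis i) c ≟V u))) ⟩
      ∑[ i ] (∑[ u ] (∑[ c ] (ι U u * 𝟙 (span (basis i) c ≟V u))))
        ≡⟨ ∑-cong (λ i → ∑-comm (λ u c → ι U u * 𝟙 (span (basis i) c ≟V u))) ⟩
      ∑[ i ] (∑[ c ] (∑[ u ] (ι U u * 𝟙 (span (basis i) c ≟V u))))
        ≡⟨ ∑-cong (λ i → ∑-cong λ c → trans (∑-cong λ u → *-comm (ι U u) _)
             (∑-point (ι U) (span (basis i) c) (span (basis i) c ≟V_) (λ e → e) refl)) ⟩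
      ∑[ i ] order (pullback (basis i) U) ∎

  -- Scaling by s ≠ 0 is undone by scaling with its inverse, so membership in U, being zero and
  -- being covered are invariant in both directions; `unscale` is this argument.
  holes-projective : ∀ U → IsProjectiveSet (holes U)
  holes-projective U = record
    { g-0 = trans (cong (ι U 0V *_) (𝟙-no (hole? 0V) (λ (0≢0 , _) → 0≢0 refl))) (*-zeroʳ (ι U 0V))
    ; g-⊙ = λ {s} s≢0 u → cong₂ _*_
        (𝟙-cong (mem? U (s ⊙ u)) (mem? U u) (unscale (mem U) (Subspace.mem-⊙ U) s≢0 u) (Subspace.mem-⊙ U s))
        (𝟙-cong (hole? (s ⊙ u)) (hole? u)
          (λ (su≢0 , ¬cov) → (su≢0 ∘ zero-scale s) , (¬cov ∘ cov-scale s {u}))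
          (λ (u≢0 , ¬cov) → (u≢0 ∘ unscale (_≡ 0V) zero-scale s≢0 u)
                          , (¬cov ∘ unscale Covered cov-scale s≢0 u)))
    ; g-idem = λ u → trans (square (ι U u) (η u)) (cong₂ _*_ (𝟙-idem (mem? U u)) (𝟙-idem (hole? u))) }
    where
    square : ∀ a b → a * b * (a * b) ≡ a * a * (b * b)
    square = solve-∀
    unscale : (P : V v → Set) → (∀ s {u} → P u → P (s ⊙ u)) → ∀ {s} → ¬ s ≡ 0F → ∀ u → P (s ⊙ u) → P u
    unscale P P-⊙ {s} s≢0 u p = subst P (⊙-cancel s≢0 u) (P-⊙ (inv s s≢0) p)
    zero-scale : ∀ s {u} → u ≡ 0V → s ⊙ u ≡ 0V
    zero-scale s refl = ⊙-0V s
    cov-scale : ∀ s {u} → Covered u → Covered (s ⊙ u)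
    cov-scale s (i , c , eq) = i , s ⊙ c , trans (span-⊙ (basis i) s c) (cong (s ⊙_) eq)

  section-holes : ∀ U f → section (holes-projective U) f ≡ #holes (U ∩ker ∙-linearʳ f)
  section-holes U f = ∑-cong λ u → trans (shuffle (ι U u) (η u) (𝟙 (f ∙ u ≟F 0F)))
    (cong (_* η u) (sym (ι-∩ker U (∙-linearʳ f) u)))
    where
    shuffle : ∀ a b c → a * b * c ≡ a * c * b
    shuffle = solve-∀

  -- The orders of subspaces are powers of q; what is needed of this is divisibility by q ^ e
  -- together with a quotient that is 1 modulo q - 1.
  PowerLike : ℕ → ℕ → Set
  PowerLike e a = ∃ λ p → a ≡ q ^ e * (1 + p * m)

  power-like-+ : ∀ d e → PowerLike e (q ^ (d + e))
  power-like-+ zero e = 0 , sym (*-identityʳ (q ^ e))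
  power-like-+ (suc d) e with power-like-+ d e
  ... | p , eq = 1 + p + p * m , trans (cong (q *_) eq) (shape m (q ^ e) p)
    where
    shape : ∀ m a p → suc m * (a * (1 + p * m)) ≡ a * (1 + (1 + p + p * m) * m)
    shape = solve-∀

  power-like-∩ker : ∀ {n e} (U : Subspace n) {φ : V n → F} (lin : IsLinear φ) →
                    PowerLike (suc e) (order U) → PowerLike e (order (U ∩ker lin))
  power-like-∩ker {e = e} U lin (p , eq) with order-∩ker U lin
  -- Here φ vanishes on the subspace and nothing is cut off. The surplus factor q = 1 + m moves into
  -- the quotient, which stays 1 modulo m.
  ... | inj₁ same = 1 + p + p * m , trans (sym same) (trans eq (shape m (q ^ e) p))
    where
    shape : ∀ m a p → (suc m * a) * (1 + p * m) ≡ a * (1 + (1 + p + p * m) * m)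
    shape = solve-∀
  ... | inj₂ less = p , *-cancelˡ-≡ _ _ q (trans (sym less) (trans eq (*-assoc q (q ^ e) _)))

  -- It holds with e = k for the whole space, and a hyperplane section costs one unit of e, since
  -- neither U nor its intersection with a member loses more than one dimension.
  Divisible : ℕ → Subspace v → Set
  Divisible e U = PowerLike e (order U) × (∀ i → PowerLike e (order (pullback (basis i) U)))

  divisible-full : v ≡ (v ∸ k) + k → Divisible k full
  divisible-full v≡ = subst (PowerLike k) (trans (cong (q ^_) (sym v≡)) (sym (order-full v))) (power-like-+ (v ∸ k) k)
    , λ i → subst (PowerLike k) (sym (order-full k)) (power-like-+ 0 k)

  divisible-∩ker : ∀ {e} U {φ : V v → F} (lin : IsLinear φ) → Divisible (suc e) U → Divisible e (U ∩ker lin)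
  divisible-∩ker {e} U lin (order-U , orders) =
    power-like-∩ker {e = e} U lin order-U ,
    λ i → power-like-∩ker {e = e} (pullback (basis i) U) (span-linear (basis i) lin) (orders i)

  -- The last field is the congruence B ≡ C + X modulo q − 1.
  record HoleResidue (l X e : ℕ) (U : Subspace v) : Set where
    field
      B C a b : ℕ
      holes≡  : #holes U + q ^ e * B ≡ X + q ^ e * C
      B≡C+X   : B + a * m ≡ C + X + b * m

  -- In h = order U + (n - 1) - (orders of the intersections with the members), substitute n - 1 = l
  -- q^k + X: the first term and l q^k make up `q ^ e * C`, the intersections make up `q ^ e * B`.
  -- Powers of q are 1 modulo m, so C ≡ 1 + l and B ≡ n ≡ 1 + l + X. The pair is kept instead of C -
  -- B because that difference may be negative.
  hole-residue : ∀ {l X e} → n ≡ suc (l * q ^ k + X) → e ≤ k → ∀ U → Divisible e U → HoleResidue l X e U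
  hole-residue {l} {X} {e} n≡ e≤k U ((p , order-U) , orders) = record
   { B = n + P * m ; C = 1 + p * m + l * (1 + p₁ * m) ; a = p + l * p₁ ; b = l * p₂ + P
   ; holes≡ = +-cancelʳ-≡ (1 + n) _ _ (begin
      h + Q * (n + P * m) + (1 + n)
        ≡⟨ shape₁ h (Q * (n + P * m)) n ⟩
      Q * (n + P * m) + h + 1 + n
        ≡⟨ cong (λ x → x + h + 1 + n) total ⟨
      ∑[ i ] order (pullback (basis i) U) + h + 1 + n
        ≡⟨ cong (_+ n) (order-decomposition U) ⟩
      order U + n + n
        ≡⟨ cong (λ x → order U + x + n) (trans n≡ (cong (λ x → suc (l * x + X)) q^k)) ⟩
      order U + suc (l * (Q * (1 + p₁ * m)) + X) + n
        ≡⟨ cong (λ x → x + suc (l * (Q * (1 + p₁ * m)) + X) + n) order-U ⟩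
      Q * (1 + p * m) + suc (l * (Q * (1 + p₁ * m)) + X) + n
        ≡⟨ shape₂ Q p m l p₁ X n ⟩
      X + Q * (1 + p * m + l * (1 + p₁ * m)) + (1 + n) ∎)
   ; B≡C+X = begin
      n + P * m + (p + l * p₁) * m
        ≡⟨ cong (λ x → x + P * m + (p + l * p₁) * m) (trans n≡ (cong (λ x → suc (l * x + X)) q^k′)) ⟩
      suc (l * (1 + p₂ * m) + X) + P * m + (p + l * p₁) * m
        ≡⟨ shape₃ l p₂ m X P p p₁ ⟩
      1 + p * m + l * (1 + p₁ * m) + X + (l * p₂ + P) * m ∎ }
    where
    open ≡-Reasoning
    p₁ p₂ : ℕ
    p₁ = proj₁ (power-like-+ (k ∸ e) e)
    p₂ = proj₁ (power-like-+ k 0)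
    Q h P : ℕ
    Q = q ^ e
    h = #holes U
    P = ∑[ i ] proj₁ (orders i)
    q^k : q ^ k ≡ Q * (1 + p₁ * m)
    q^k = trans (cong (q ^_) (sym (m∸n+n≡m e≤k))) (proj₂ (power-like-+ (k ∸ e) e))
    q^k′ : q ^ k ≡ 1 + p₂ * m
    q^k′ = trans (cong (q ^_) (sym (+-identityʳ k))) (trans (proj₂ (power-like-+ k 0)) (*-identityˡ _))
    total : ∑[ i ] order (pullback (basis i) U) ≡ Q * (n + P * m)
    total = begin
      ∑[ i ] order (pullback (basis i) U)        ≡⟨ ∑-cong (λ i → proj₂ (orders i)) ⟩
      ∑[ i ] (Q * (1 + proj₁ (orders i) * m))    ≡⟨ ∑-*ˡ Q (λ i → 1 + proj₁ (orders i) * m) ⟩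
      Q * (∑[ i ] (1 + proj₁ (orders i) * m))    ≡⟨ cong (Q *_) (∑-+ (λ _ → 1) (λ i → proj₁ (orders i) * m)) ⟩
      Q * (∑ {Fin n} (λ _ → 1) + ∑[ i ] (proj₁ (orders i) * m))
        ≡⟨ cong (Q *_) (cong₂ _+_ (trans (∑-const {Fin n} 1) (*-identityʳ n)) (∑-*ʳ m (proj₁ ∘ orders))) ⟩
      Q * (n + P * m) ∎
    shape₁ : ∀ h x n → h + x + (1 + n) ≡ x + h + 1 + n
    shape₁ = solve-∀
    shape₂ : ∀ Q p m l p₁ X n → Q * (1 + p * m) + suc (l * (Q * (1 + p₁ * m)) + X) + n
                              ≡ X + Q * (1 + p * m + l * (1 + p₁ * m)) + (1 + n)
    shape₂ = solve-∀
    shape₃ : ∀ l p₂ m X P p p₁ → suc (l * (1 + p₂ * m) + X) + P * m + (p + l * p₁) * m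
                               ≡ 1 + p * m + l * (1 + p₁ * m) + X + (l * p₂ + P) * m
    shape₃ = solve-∀

-- Descent to codimension k − y and the quadratic bound

≤-witness : ∀ {a b} → a ≤ b → ∃ λ c → b ≡ a + c
≤-witness a≤b = _ , sym (m+[n∸m]≡n a≤b)

-- A positive multiple of m is at least m.
congruent-gap : ∀ m a b s t → a + s * m ≡ b + t * m → a < b → a + m ≤ b
congruent-gap m a b s t eq a<b with ≤-witness a<b
... | d , refl = subst (a + m ≤_) (+-suc a d) (+-monoʳ-≤ a (∣⇒≤
      (∣m+n∣m⇒∣n (divides s (sym (+-cancelˡ-≡ a _ _ (trans eq (shape a d (t * m)))))) (n∣m*n t))))
  where
  shape : ∀ a d x → suc (a + d) + x ≡ a + (x + suc d)
  shape = solve-∀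

-- (h − g)(h − g + R) ≥ 0 when h does not lie strictly between g − R and g, without subtraction.
quadratic-slack : ∀ h g R → g ≤ h ⊎ h + R ≤ g → 2 * g * h + R * g ≤ h * h + g * g + R * h
quadratic-slack h g R (inj₁ g≤h) with ≤-witness g≤h
... | d , refl = m+n≤o⇒m≤o (2 * g * (g + d) + R * g) (≤-reflexive (shape g d R))
  where
  shape : ∀ g d R → 2 * g * (g + d) + R * g + d * (d + R) ≡ (g + d) * (g + d) + g * g + R * (g + d)
  shape = solve-∀
quadratic-slack h g R (inj₂ h+R≤g) with ≤-witness h+R≤g
... | d , refl = m+n≤o⇒m≤o (2 * (h + R + d) * h + R * (h + R + d)) (≤-reflexive (shape h d R))
  where
  shape : ∀ h d R → 2 * (h + R + d) * h + R * (h + R + d) + d * (d + R) ≡ h * h + (h + R + d) * (h + R + d) + R * h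
  shape = solve-∀

module Descent {m : ℕ} (1≤m : 1 ≤ m) (K : FiniteField (suc m)) {v k n : ℕ} (S : PartialSpread K v k n)
               {l X : ℕ} (n≡ : n ≡ suc (l * suc m ^ k + X)) (1≤X : 1 ≤ X) where
  open LinearAlgebra K
  open Moments K
  open Holes K S

  private
    q : ℕ
    q = suc m

    instance
      m-nonZero : NonZero m
      m-nonZero = >-nonZero 1≤m

  record HoleLevel (e w : ℕ) (U : Subspace v) : Set where
    field
      divisible  : Divisible e U
      #holes≡    : #holes U ≡ X + q ^ e * w
      m-residue  : m ∣ X + w

  -- The number of holes is X + q^e (C - B). Since X < q^e, a negative C - B would make it negative;
  -- hence w = C - B is a natural number, and w ≡ -X modulo m.
  level : ∀ {e} → X < q ^ e → e ≤ k → ∀ U → Divisible e U → ∃ λ w → HoleLevel e w U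
  level {e} X<Q e≤k U div = w , record
      { divisible = div
      ; #holes≡ = +-cancelʳ-≡ (Q * B) _ _ (trans holes≡ (trans (cong (λ x → X + Q * x) C≡) (shape X Q B w)))
      ; m-residue = ∣m+n∣m⇒∣n (divides a (sym (+-cancelˡ-≡ B _ _ (trans B≡C+X
          (trans (cong (λ x → x + X + b * m) C≡) (shape′ B w X (b * m))))))) (n∣m*n b) }
    where
    residue : HoleResidue l X e U
    residue = hole-residue n≡ e≤k U div
    open HoleResidue residue
    Q w : ℕ
    Q = q ^ e
    w = C ∸ B
    B≤C : B ≤ C
    B≤C = ≮⇒≥ λ C<B → <-irrefl (sym holes≡) (begin-strict
      X + Q * C              <⟨ +-monoˡ-< (Q * C) X<Q ⟩
      Q + Q * C              ≡⟨ *-suc Q C ⟨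
      Q * suc C              ≤⟨ *-monoʳ-≤ Q C<B ⟩
      Q * B                  ≤⟨ m≤n+m (Q * B) (#holes U) ⟩
      #holes U + Q * B       ∎)
      where open ≤-Reasoning
    C≡ : C ≡ B + w
    C≡ = sym (m+[n∸m]≡n B≤C)
    shape : ∀ X Q B w → X + Q * (B + w) ≡ X + Q * w + Q * B
    shape = solve-∀
    shape′ : ∀ B w X y → B + w + X + y ≡ B + (y + (X + w))
    shape′ = solve-∀

  -- For a functional with at most average section, q X + q^(e+1) w′ ≤ X + q^(e+1) w. As X ≥ 1 and q
  -- > 1, this forces w′ < w. Both are congruent to -X modulo m, so they differ by at least m.
  descend : ∀ {e w U} → X < q ^ e → e ≤ k → HoleLevel (suc e) w U → ∃₂ λ w′ U′ → HoleLevel e w′ U′ × w′ + m ≤ w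
  descend {e} {w} {U} X<Q e≤k lev = w′ , U′ , lev′ , congruent-gap m w′ w s t residues w′<w
    where
    open HoleLevel
    few : ∃ λ f → q * section (holes-projective U) f ≤ #holes U
    few = below-average (λ f → q * section (holes-projective U) f) (#holes U) (m^n>0 q v)
      (≤-reflexive (trans (∑-*ˡ q (section (holes-projective U))) (first-moment (holes-projective U))))
    f : V v
    f = proj₁ few
    U′ : Subspace v
    U′ = U ∩ker ∙-linearʳ f
    next : ∃ λ w′ → HoleLevel e w′ U′
    next = level X<Q e≤k U′ (divisible-∩ker {e} U (∙-linearʳ f) (divisible lev))
    w′ : ℕ
    w′ = proj₁ next
    lev′ : HoleLevel e w′ U′
    lev′ = proj₂ next
    w′<w : w′ < w
    w′<w = ≰⇒> λ w≤w′ → <-irrefl refl (begin-strict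
      X + q ^ suc e * w               <⟨ +-monoˡ-< (q ^ suc e * w) (m<m*n X q ⦃ >-nonZero 1≤X ⦄ (s≤s 1≤m)) ⟩
      X * q + q ^ suc e * w           ≤⟨ +-monoʳ-≤ (X * q) (*-monoʳ-≤ (q ^ suc e) w≤w′) ⟩
      X * q + q ^ suc e * w′          ≡⟨ shape X q (q ^ e) w′ ⟩
      q * (X + q ^ e * w′)            ≡⟨ cong (q *_) (trans (section-holes U f) (#holes≡ lev′)) ⟨
      q * section (holes-projective U) f ≤⟨ proj₂ few ⟩
      #holes U                        ≡⟨ #holes≡ lev ⟩
      X + q ^ suc e * w               ∎)
      where
      open ≤-Reasoning
      shape : ∀ X q Q w → X * q + (q * Q) * w ≡ q * (X + Q * w)
      shape = solve-∀
    open _∣_ (m-residue lev) renaming (quotient to s; equality to s-eq)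
    open _∣_ (m-residue lev′) renaming (quotient to t; equality to t-eq)
    residues : w′ + s * m ≡ w + t * m
    residues = begin
      w′ + s * m     ≡⟨ cong (w′ +_) s-eq ⟨
      w′ + (X + w)   ≡⟨ shape w′ X w ⟩
      w + (X + w′)   ≡⟨ cong (w +_) t-eq ⟩
      w + t * m      ∎
      where
      open ≡-Reasoning
      shape : ∀ a b c → a + (b + c) ≡ c + (b + a)
      shape = solve-∀

  descend* : ∀ d {y w U} → X < q ^ y → d + y ≤ k → HoleLevel (d + y) w U →
             ∃₂ λ w′ U′ → HoleLevel y w′ U′ × w′ + d * m ≤ w
  descend* zero {w = w} {U} X<Q e≤k lev = w , U , lev , ≤-reflexive (+-identityʳ w)
  descend* (suc d) {y} {w} X<Q e≤k lev = w₂ , proj₁ (proj₂ rest) , proj₁ (proj₂ (proj₂ rest)) , (begin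
      w₂ + (m + d * m)   ≡⟨ shape w₂ m (d * m) ⟩
      w₂ + d * m + m     ≤⟨ +-monoˡ-≤ m (proj₂ (proj₂ (proj₂ rest))) ⟩
      w₁ + m             ≤⟨ proj₂ (proj₂ (proj₂ step)) ⟩
      w                  ∎)
    where
    open ≤-Reasoning
    d+y≤k : d + y ≤ k
    d+y≤k = ≤-trans (n≤1+n _) e≤k
    step : ∃₂ λ w′ U′ → HoleLevel (d + y) w′ U′ × w′ + m ≤ w
    step = descend (<-≤-trans X<Q (^-monoʳ-≤ q (m≤n+m y d))) d+y≤k lev
    w₁ w₂ : ℕ
    w₁ = proj₁ step
    rest : ∃₂ λ w′ U′ → HoleLevel y w′ U′ × w′ + d * m ≤ w₁
    rest = descend* d X<Q d+y≤k (proj₁ (proj₂ (proj₂ step)))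
    w₂ = proj₁ rest
    shape : ∀ a b c → a + (b + c) ≡ a + c + b
    shape = solve-∀

  -- The quadratic inequality at one level

  module _ {e w U} (e≤k : e ≤ k) (lev : HoleLevel (suc e) w U) where
    open HoleLevel lev

    private
      Q R g h W S₁ S₂ : ℕ
      Q = q ^ e
      R = Q * m
      g = X + Q * w
      h = #holes U
      W = q ^ v
      g-proj : IsProjectiveSet (holes U)
      g-proj = holes-projective U
      τ : V v → ℕ
      τ = section g-proj
      S₁ = ∑ τ
      S₂ = ∑[ f ] (τ f * τ f)

    -- The difference τ f - g is Q (C - B - w), and C - B ≡ -X ≡ w modulo m, so it is a multiple of
    -- R = Q m. Since X may exceed Q, `level` does not apply to the section and C - B may be
    -- negative.
    section-gap : ∀ f → g ≤ τ f ⊎ τ f + R ≤ g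
    section-gap f = [ below , above ]′ (≤-<-connex (B + w) C)
      where
      open ≤-Reasoning
      residue : HoleResidue l X e (U ∩ker ∙-linearʳ f)
      residue = hole-residue n≡ e≤k (U ∩ker ∙-linearʳ f) (divisible-∩ker {e} U (∙-linearʳ f) divisible)
      open HoleResidue residue
      open _∣_ m-residue renaming (quotient to s; equality to s-eq)
      shape₁ : ∀ a b c → a + b + c ≡ a + c + b
      shape₁ = solve-∀
      shape₂ : ∀ X Q C m → X + Q * C + Q * m ≡ X + Q * (C + m)
      shape₂ = solve-∀
      shape₃ : ∀ X Q B w → X + Q * (B + w) ≡ X + Q * w + Q * B
      shape₃ = solve-∀
      residues : C + (s + b) * m ≡ B + w + a * m
      residues = begin-equality
        C + (s + b) * m          ≡⟨ r₁ C s b m ⟩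
        C + (s * m) + b * m      ≡⟨ cong (λ x → C + x + b * m) s-eq ⟨
        C + (X + w) + b * m      ≡⟨ r₂ C X w (b * m) ⟩
        C + X + b * m + w        ≡⟨ cong (_+ w) B≡C+X ⟨
        B + a * m + w            ≡⟨ shape₁ B (a * m) w ⟩
        B + w + a * m            ∎
        where
        r₁ : ∀ C s b m → C + (s + b) * m ≡ C + s * m + b * m
        r₁ = solve-∀
        r₂ : ∀ C X w y → C + (X + w) + y ≡ C + X + y + w
        r₂ = solve-∀
      τ+QB : τ f + Q * B ≡ X + Q * C
      τ+QB = trans (cong (_+ Q * B) (section-holes U f)) holes≡
      below : B + w ≤ C → g ≤ τ f ⊎ τ f + R ≤ g
      below B+w≤C = inj₁ (+-cancelʳ-≤ (Q * B) g (τ f) (begin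
        g + Q * B           ≡⟨ shape₃ X Q B w ⟨
        X + Q * (B + w)     ≤⟨ +-monoʳ-≤ X (*-monoʳ-≤ Q B+w≤C) ⟩
        X + Q * C           ≡⟨ τ+QB ⟨
        τ f + Q * B         ∎))
      above : C < B + w → g ≤ τ f ⊎ τ f + R ≤ g
      above C<B+w = inj₂ (+-cancelʳ-≤ (Q * B) (τ f + R) g (begin
        τ f + R + Q * B     ≡⟨ trans (shape₁ (τ f) R (Q * B)) (cong (_+ R) τ+QB) ⟩
        X + Q * C + Q * m   ≡⟨ shape₂ X Q C m ⟩
        X + Q * (C + m)     ≤⟨ +-monoʳ-≤ X (*-monoʳ-≤ Q (congruent-gap m C (B + w) (s + b) a residues C<B+w)) ⟩
        X + Q * (B + w)     ≡⟨ shape₃ X Q B w ⟩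
        g + Q * B           ∎))

    private
      -- `slack f` is the product (τ f - g)(τ f - g + R), with its positive and negative terms
      -- separated; by `quadratic-slack` the truncated subtraction is exact.
      lhs rhs slack : V v → ℕ
      lhs f = τ f * τ f + g * g + R * τ f
      rhs f = 2 * g * τ f + R * g
      slack f = lhs f ∸ rhs f

    ∑-slack : S₂ + W * (g * g) + R * S₁ ≡ 2 * g * S₁ + W * (R * g) + ∑ slack
    ∑-slack = begin
      S₂ + W * (g * g) + R * S₁
        ≡⟨ cong₂ (λ x y → S₂ + x + y) (∑-const {V v} (g * g)) (∑-*ˡ R τ) ⟨
      S₂ + ∑ {V v} (λ _ → g * g) + ∑[ f ] (R * τ f)
        ≡⟨ cong (_+ ∑ (λ f → R * τ f)) (∑-+ (λ f → τ f * τ f) (λ _ → g * g)) ⟨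
      ∑[ f ] (τ f * τ f + g * g) + ∑[ f ] (R * τ f)
        ≡⟨ ∑-+ (λ f → τ f * τ f + g * g) (λ f → R * τ f) ⟨
      ∑ lhs
        ≡⟨ ∑-cong (λ f → sym (m+[n∸m]≡n (quadratic-slack (τ f) g R (section-gap f)))) ⟩
      ∑[ f ] (rhs f + slack f)
        ≡⟨ ∑-+ rhs slack ⟩
      ∑ rhs + ∑ slack
        ≡⟨ cong (_+ ∑ slack) (∑-+ (λ f → 2 * g * τ f) (λ _ → R * g)) ⟩
      ∑[ f ] (2 * g * τ f) + ∑ {V v} (λ _ → R * g) + ∑ slack
        ≡⟨ cong₂ (λ x y → x + y + ∑ slack) (∑-*ˡ (2 * g) τ) (∑-const {V v} (R * g)) ⟩
      2 * g * S₁ + W * (R * g) + ∑ slack ∎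
      where open ≡-Reasoning

    -- The zero functional cuts nothing off, so its section has all h = g + R w holes and its slack
    -- is R w (R w + R).
    slack-0 : 0 < w → 0 < ∑ slack
    slack-0 0<w = <-≤-trans (subst (0 <_) (sym slack-0V) positive) (term≤∑ slack 0V)
      where
      D : ℕ
      D = R * w
      τ0 : τ 0V ≡ g + D
      τ0 = trans (section-0 g-proj) (trans #holes≡ (shape X m Q w))
        where
        shape : ∀ X m Q w → X + (suc m * Q) * w ≡ X + Q * w + Q * m * w
        shape = solve-∀
      slack-0V : slack 0V ≡ D * (D + R)
      slack-0V = trans (cong (_∸ rhs 0V) (trans (cong (λ x → x * x + g * g + R * x) τ0)
        (trans (shape g D R) (cong (λ x → 2 * g * x + R * g + D * (D + R)) (sym τ0))))) (m+n∸m≡n (rhs 0V) (D * (D + R)))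
        where
        shape : ∀ g d R → (g + d) * (g + d) + g * g + R * (g + d) ≡ 2 * g * (g + d) + R * g + d * (d + R)
        shape = solve-∀
      positive : 0 < D * (D + R)
      positive = *-mono-< 0<D (<-≤-trans 0<D (m≤m+n D R))
        where
        0<D : 0 < D
        0<D = *-mono-< {0} {R} {0} {w} (*-mono-< {0} {Q} {0} {m} (m^n>0 q e) 1≤m) 0<w

    -- q² ∑ f (τ f − g)(τ f − g + R) evaluated with the two moments of τ; Z collects the terms that
    -- would cancel under subtraction.
    slack-identity : W * (m * m) * (X * X + X + q ^ suc e * w)
                   ≡ W * (m * m) * (q ^ suc e * X) + q * q * ∑ slack
    slack-identity = +-cancelˡ-≡ Z _ _ (begin
      Z + W * (m * m) * (X * X + X + q * Q * w)
        ≡⟨ shape₁ m Q w X W ⟩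
      W * (H * H + m * m * H) + q * q * (W * (g * g)) + R * q * (W * H)
        ≡⟨ cong (λ h → W * (h * h + m * m * h) + q * q * (W * (g * g)) + R * q * (W * h)) #holes≡ ⟨
      W * (h * h + m * m * h) + q * q * (W * (g * g)) + R * q * (W * h)
        ≡⟨ cong₂ (λ x y → x + q * q * (W * (g * g)) + R * q * y) (second-moment g-proj) (first-moment g-proj) ⟨
      q * q * S₂ + q * q * (W * (g * g)) + R * q * (q * S₁)
        ≡⟨ shape₂ q S₂ (W * (g * g)) R S₁ ⟩
      q * q * (S₂ + W * (g * g) + R * S₁)
        ≡⟨ cong (q * q *_) ∑-slack ⟩
      q * q * (2 * g * S₁ + W * (R * g) + ∑ slack)
        ≡⟨ shape₃ q g S₁ (W * (R * g)) (∑ slack) ⟩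
      2 * q * g * (q * S₁) + q * q * (W * (R * g)) + q * q * ∑ slack
        ≡⟨ cong (λ x → 2 * q * g * x + q * q * (W * (R * g)) + q * q * ∑ slack)
             (trans (first-moment g-proj) (cong (W *_) #holes≡)) ⟩
      2 * q * g * (W * H) + q * q * (W * (R * g)) + q * q * ∑ slack
        ≡⟨ shape₄ m Q w X W (q * q * ∑ slack) ⟩
      Z + (W * (m * m) * (q * Q * X) + q * q * ∑ slack) ∎)
      where
      open ≡-Reasoning
      H Z : ℕ
      H = X + q * Q * w
      Z = W * (2 * q * g * H + q * Q * m * H)
      shape₁ : ∀ m Q w X W →
        W * (2 * suc m * (X + Q * w) * (X + suc m * Q * w) + suc m * Q * m * (X + suc m * Q * w))
          + W * (m * m) * (X * X + X + suc m * Q * w)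
        ≡ W * ((X + suc m * Q * w) * (X + suc m * Q * w) + m * m * (X + suc m * Q * w))
          + suc m * suc m * (W * ((X + Q * w) * (X + Q * w))) + Q * m * suc m * (W * (X + suc m * Q * w))
      shape₁ = solve-∀
      shape₂ : ∀ q S₂ G R S₁ → q * q * S₂ + q * q * G + R * q * (q * S₁) ≡ q * q * (S₂ + G + R * S₁)
      shape₂ = solve-∀
      shape₃ : ∀ q g S₁ G s → q * q * (2 * g * S₁ + G + s) ≡ 2 * q * g * (q * S₁) + q * q * G + q * q * s
      shape₃ = solve-∀
      shape₄ : ∀ m Q w X W s →
        2 * suc m * (X + Q * w) * (W * (X + suc m * Q * w)) + suc m * suc m * (W * (Q * m * (X + Q * w))) + s
        ≡ W * (2 * suc m * (X + Q * w) * (X + suc m * Q * w) + suc m * Q * m * (X + suc m * Q * w))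
          + (W * (m * m) * (suc m * Q * X) + s)
      shape₄ = solve-∀

    private instance
      Wm²-nonZero : NonZero (W * (m * m))
      Wm²-nonZero = >-nonZero (*-mono-< {0} {W} {0} {m * m} (m^n>0 q v) (*-mono-< {0} {m} {0} {m} 1≤m 1≤m))

    quadratic-bound : q ^ suc e * X ≤ X * X + X + q ^ suc e * w
    quadratic-bound = *-cancelˡ-≤ (W * (m * m)) (subst (W * (m * m) * (q ^ suc e * X) ≤_) (sym slack-identity) (m≤m+n _ _))

    quadratic-bound-strict : 0 < w → q ^ suc e * X < X * X + X + q ^ suc e * w
    quadratic-bound-strict 0<w = *-cancelˡ-< (W * (m * m)) _ _
      (subst (W * (m * m) * (q ^ suc e * X) <_) (sym slack-identity)
        (m<m+n _ (*-mono-< {0} {q * q} {0} {∑ slack} (s≤s z≤n) (slack-0 0<w))))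

  -- On the whole space the count reads n q^k + h + 1 = q^v + n. With n = l q^k + X + 1 and q^(v-k)
  -- = l q^k + q^r - l it gives h = X + q^k (q^r - X - 1). The term l q^k is added on both sides so
  -- that the sum q^(v-k) + l can be replaced without subtraction.
  initial-level : ∀ {r} → v ≡ (v ∸ k) + k → q ^ (v ∸ k) + l ≡ l * q ^ k + q ^ r → X < q ^ k →
                  ∃ λ w → HoleLevel k w full × suc (X + w) ≡ q ^ r
  initial-level {r} v≡ q^[v-k] X<q^k = w , lev , *-cancelˡ-≡ _ _ Qk ⦃ >-nonZero (m^n>0 q k) ⦄ (+-cancelʳ-≡ (l * Qk * Qk + X + l * Qk + 1) _ _ (begin
      Qk * suc (X + w) + (l * Qk * Qk + X + l * Qk + 1)
        ≡⟨ shape₁ Qk X w l ⟩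
      suc (l * Qk + X) * Qk + (X + Qk * w) + 1 + l * Qk
        ≡⟨ cong₂ (λ a b → a * Qk + b + 1 + l * Qk) n≡ (HoleLevel.#holes≡ lev) ⟨
      n * Qk + #holes full + 1 + l * Qk
        ≡⟨ cong (λ a → a + #holes full + 1 + l * Qk) orders ⟨
      ∑[ i ] order (pullback (PartialSpread.basis S i) full) + #holes full + 1 + l * Qk
        ≡⟨ cong (_+ l * Qk) (order-decomposition full) ⟩
      order (full {v}) + n + l * Qk
        ≡⟨ cong₂ (λ a b → a + b + l * Qk) (trans (order-full v) (trans (cong (q ^_) v≡) (^-distribˡ-+-* q (v ∸ k) k))) n≡ ⟩
      q ^ (v ∸ k) * Qk + suc (l * Qk + X) + l * Qk
        ≡⟨ shape₂ (q ^ (v ∸ k)) Qk l X ⟩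
      (q ^ (v ∸ k) + l) * Qk + suc (l * Qk + X)
        ≡⟨ cong (λ a → a * Qk + suc (l * Qk + X)) q^[v-k] ⟩
      (l * Qk + q ^ r) * Qk + suc (l * Qk + X)
        ≡⟨ shape₃ l Qk (q ^ r) X ⟩
      Qk * q ^ r + (l * Qk * Qk + X + l * Qk + 1) ∎))
    where
    open ≡-Reasoning
    start : ∃ λ w → HoleLevel k w full
    start = level X<q^k ≤-refl full (divisible-full v≡)
    w : ℕ
    w = proj₁ start
    lev : HoleLevel k w full
    lev = proj₂ start
    Qk : ℕ
    Qk = q ^ k
    orders : ∑[ i ] order (pullback (PartialSpread.basis S i) full) ≡ n * Qk
    orders = trans (∑-cong λ i → order-full k) (∑-const {Fin n} Qk)
    shape₁ : ∀ Q X w l → Q * suc (X + w) + (l * Q * Q + X + l * Q + 1) ≡ suc (l * Q + X) * Q + (X + Q * w) + 1 + l * Q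
    shape₁ = solve-∀
    shape₂ : ∀ A Q l X → A * Q + suc (l * Q + X) + l * Q ≡ (A + l) * Q + suc (l * Q + X)
    shape₂ = solve-∀
    shape₃ : ∀ l Q A X → (l * Q + A) * Q + suc (l * Q + X) ≡ Q * A + (l * Q * Q + X + l * Q + 1)
    shape₃ = solve-∀

  -- Here `suc e` is y and d = k - y is the number of descent steps. The bound X < q^(suc e) keeps w
  -- a natural number down to this level; the further sections, with exponent e, enter through
  -- `section-gap`.
  conclusion : ∀ {r d e} → v ≡ (v ∸ k) + k → q ^ (v ∸ k) + l ≡ l * q ^ k + q ^ r → k ≡ d + suc e → X < q ^ suc e →
    ∃ λ w → suc (X + w) + d * m ≤ q ^ r
          × q ^ suc e * X ≤ X * X + X + q ^ suc e * w
          × (0 < w → q ^ suc e * X < X * X + X + q ^ suc e * w)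
  conclusion {r} {d} {e} v≡ q^[v-k] refl X<λ = finish (initial-level {r} v≡ q^[v-k] (<-≤-trans X<λ (^-monoʳ-≤ q (m≤n+m (suc e) d))))
    where
    Conclusion : Set
    Conclusion = ∃ λ w → suc (X + w) + d * m ≤ q ^ r
          × q ^ suc e * X ≤ X * X + X + q ^ suc e * w
          × (0 < w → q ^ suc e * X < X * X + X + q ^ suc e * w)
    e≤k : e ≤ d + suc e
    e≤k = ≤-trans (n≤1+n e) (m≤n+m (suc e) d)
    finish′ : ∀ {w₀} → suc (X + w₀) ≡ q ^ r → (∃₂ λ w U → HoleLevel (suc e) w U × w + d * m ≤ w₀) → Conclusion
    finish′ eq (w , U , lev , w+dm≤w₀) = w
      , subst₂ _≤_ (sym (+-assoc (suc X) w (d * m))) eq (+-monoʳ-≤ (suc X) w+dm≤w₀)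
      , quadratic-bound e≤k lev , quadratic-bound-strict e≤k lev
    finish : (∃ λ w → HoleLevel k w full × suc (X + w) ≡ q ^ r) → Conclusion
    finish (w₀ , lev₀ , eq) = finish′ eq (descend* d X<λ ≤-refl lev₀)

-- The ceiling and the theorem

restrict : ∀ {q} {K : FiniteField q} {v k n n′} → n′ ≤ n → PartialSpread K v k n → PartialSpread K v k n′
restrict n′≤n S = record
  { basis = basis ∘ λ i → Fin.inject≤ i n′≤n
  ; indep = λ i → indep (Fin.inject≤ i n′≤n)
  ; disjoint = λ i j i≢j → disjoint _ _ (i≢j ∘ Finₚ.inject≤-injective n′≤n n′≤n i j) }
  where
  open PartialSpread S

field-size>1 : ∀ {q} → FiniteField q → 1 < q
field-size>1 {zero} K with Inverse.to (FiniteField.card K) (FiniteField.0F K)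
... | ()
field-size>1 {suc zero} K = contradiction
  (Injection.injective (↔⇒↣ card) (Fin1-unique (Inverse.to card 0F) (Inverse.to card 1F))) 0≢1
  where
  open FiniteField K
  Fin1-unique : (i j : Fin 1) → i ≡ j
  Fin1-unique zero zero = refl
field-size>1 {suc (suc q)} K = s≤s z<s

-- With u = λ - β - 1 the discriminant is the natural number 1 + 4λu, so squares can be compared in
-- ℕ.
module Ceiling {β u : ℕ} (1≤β : 1 ≤ β) where

  private
    lam : ℕ
    lam = suc (β + u)

  discriminant : ⁺ 1 +ᶻ ⁺ 4 *ᶻ ⁺ lam *ᶻ (⁺ lam -ᶻ ⁺ β -ᶻ ⁺ 1) ≡ ⁺ (1 + 4 * lam * u)
  discriminant = begin
    ⁺ 1 +ᶻ ⁺ 4 *ᶻ ⁺ lam *ᶻ (⁺ lam -ᶻ ⁺ β -ᶻ ⁺ 1)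
      ≡⟨ cong (λ x → ⁺ 1 +ᶻ ⁺ 4 *ᶻ ⁺ lam *ᶻ x) (shape (⁺ β) (⁺ u)) ⟩
    ⁺ 1 +ᶻ ⁺ 4 *ᶻ ⁺ lam *ᶻ ⁺ u
      ≡⟨ cong (⁺ 1 +ᶻ_) (trans (cong (_*ᶻ ⁺ u) (sym (ℤₚ.pos-* 4 lam))) (sym (ℤₚ.pos-* (4 * lam) u))) ⟩
    ⁺ (1 + 4 * lam * u) ∎
    where
    open ≡-Reasoning
    shape : ∀ b u → ⁺ 1 +ᶻ (b +ᶻ u) -ᶻ b -ᶻ ⁺ 1 ≡ u
    shape = ℤSolver.solve-∀

  square-bound : ∀ {s} → LeSqrt (⁺ (suc s)) (⁺ (1 + 4 * lam * u)) → suc s * suc s ≤ 1 + 4 * lam * u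
  square-bound (inj₁ (+≤+ ()))
  square-bound {s} (inj₂ s²≤D) = drop‿+≤+ (subst (_≤ᶻ ⁺ (1 + 4 * lam * u)) (sym (ℤₚ.pos-* (suc s) (suc s))) s²≤D)

  lower-side : ∀ p → ⁺ 2 *ᶻ ⁺ lam -ᶻ ⁺ 1 -ᶻ ⁺ 2 *ᶻ (-ᶻ ⁺ p) ≡ ⁺ (suc (2 * (β + u + p)))
  lower-side p = trans (shape (⁺ β) (⁺ u) (⁺ p)) (cong (⁺ 1 +ᶻ_) (sym (ℤₚ.pos-* 2 (β + u + p))))
    where
    shape : ∀ b u p → ⁺ 2 *ᶻ (⁺ 1 +ᶻ (b +ᶻ u)) -ᶻ ⁺ 1 -ᶻ ⁺ 2 *ᶻ (-ᶻ p) ≡ ⁺ 1 +ᶻ ⁺ 2 *ᶻ (b +ᶻ u +ᶻ p)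
    shape = ℤSolver.solve-∀

  -- At the value -p the left side is at least 2λ - 1, and (2λ - 1)² exceeds the discriminant by
  -- 4λβ, which is positive.
  nonpositive-impossible : ∀ p → ¬ LeSqrt (⁺ 2 *ᶻ ⁺ lam -ᶻ ⁺ 1 -ᶻ ⁺ 2 *ᶻ (-ᶻ ⁺ p)) (⁺ (1 + 4 * lam * u))
  nonpositive-impossible p le = <-irrefl refl (begin-strict
    1 + 4 * lam * u                             <⟨ m<m+n _ (*-mono-< {0} {4 * lam} {0} {β} z<s 1≤β) ⟩
    1 + 4 * lam * u + 4 * lam * β               ≡⟨ shape β u ⟩
    suc (2 * (β + u)) * suc (2 * (β + u))       ≤⟨ *-mono-≤ mono mono ⟩
    suc (2 * (β + u + p)) * suc (2 * (β + u + p)) ≤⟨ square-bound (subst (λ a → LeSqrt a _) (lower-side p) le) ⟩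
    1 + 4 * lam * u                             ∎)
    where
    open ≤-Reasoning
    mono : suc (2 * (β + u)) ≤ suc (2 * (β + u + p))
    mono = s≤s (*-monoʳ-≤ 2 (m≤m+n (β + u) p))
    shape : ∀ β u → 1 + 4 * suc (β + u) * u + 4 * suc (β + u) * β ≡ suc (2 * (β + u)) * suc (2 * (β + u))
    shape = solve-∀

  -- At λ itself the left side is 1, while the discriminant is at least 1; beyond λ the left side is
  -- negative.
  too-large-impossible : ∀ d → ¬ GtSqrt (⁺ 2 *ᶻ ⁺ lam +ᶻ ⁺ 1 -ᶻ ⁺ 2 *ᶻ ⁺ (lam + d)) (⁺ (1 + 4 * lam * u))
  too-large-impossible d gt = go d (subst (λ a → GtSqrt a _) (shape (⁺ lam) (⁺ d)) gt)
    where
    shape : ∀ l d → ⁺ 2 *ᶻ l +ᶻ ⁺ 1 -ᶻ ⁺ 2 *ᶻ (l +ᶻ d) ≡ ⁺ 1 -ᶻ ⁺ 2 *ᶻ d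
    shape = ℤSolver.solve-∀
    go : ∀ d → ¬ GtSqrt (⁺ 1 -ᶻ ⁺ 2 *ᶻ ⁺ d) (⁺ (1 + 4 * lam * u))
    go zero (_ , +<+ (s≤s ()))
    go (suc d) (0<a , _) with subst (⁺ 0 <ᶻ_) (negative (⁺ d)) 0<a
      where
      negative : ∀ d → ⁺ 1 -ᶻ ⁺ 2 *ᶻ (⁺ 1 +ᶻ d) ≡ -ᶻ (⁺ 1 +ᶻ (d +ᶻ d))
      negative = ℤSolver.solve-∀
    ... | ()

  ceiling-bounds : ∀ {c} → IsCeilExpr (⁺ lam) (⁺ 1 +ᶻ ⁺ 4 *ᶻ ⁺ lam *ᶻ (⁺ lam -ᶻ ⁺ β -ᶻ ⁺ 1)) c →
                   ∃ λ X → c ≡ ⁺ X × 1 ≤ X × X < lam × X * X + X + lam * β ≤ 2 * lam * X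
  ceiling-bounds {c} ceil = go (subst (λ D → IsCeilExpr (⁺ lam) D c) discriminant ceil)
    where
    go : ∀ {c} → IsCeilExpr (⁺ lam) (⁺ (1 + 4 * lam * u)) c →
         ∃ λ X → c ≡ ⁺ X × 1 ≤ X × X < lam × X * X + X + lam * β ≤ 2 * lam * X
    go { -[1+ p ]} (le , _) = contradiction le (nonpositive-impossible (suc p))
    go {⁺ zero} (le , _) = contradiction le (nonpositive-impossible 0)
    go {⁺ X@(suc _)} (le , gt) = X , refl , s≤s z≤n , X<lam , bound
      where
      X<lam : X < lam
      X<lam = ≰⇒> λ lam≤X → too-large-impossible (X ∸ lam)
        (subst (λ x → GtSqrt (⁺ 2 *ᶻ ⁺ lam +ᶻ ⁺ 1 -ᶻ ⁺ 2 *ᶻ ⁺ x) (⁺ (1 + 4 * lam * u))) (sym (m+[n∸m]≡n lam≤X)) gt)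
      t : ℕ
      t = lam ∸ suc X
      lam≡ : lam ≡ suc X + t
      lam≡ = sym (m+[n∸m]≡n X<lam)
      side : ⁺ 2 *ᶻ ⁺ lam -ᶻ ⁺ 1 -ᶻ ⁺ 2 *ᶻ ⁺ X ≡ ⁺ (suc (2 * t))
      side = trans (cong (λ x → ⁺ 2 *ᶻ ⁺ x -ᶻ ⁺ 1 -ᶻ ⁺ 2 *ᶻ ⁺ X) lam≡)
        (trans (shape (⁺ X) (⁺ t)) (cong (⁺ 1 +ᶻ_) (sym (ℤₚ.pos-* 2 t))))
        where
        shape : ∀ x t → ⁺ 2 *ᶻ (⁺ 1 +ᶻ x +ᶻ t) -ᶻ ⁺ 1 -ᶻ ⁺ 2 *ᶻ x ≡ ⁺ 1 +ᶻ ⁺ 2 *ᶻ t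
        shape = ℤSolver.solve-∀
      -- With t = λ - X - 1 the lower half of the ceiling condition is (2t + 1)² ≤ 1 + 4λu;
      -- expanded, this is four times the claim.
      bound : X * X + X + lam * β ≤ 2 * lam * X
      bound = *-cancelˡ-≤ 4 (+-cancelʳ-≤ (1 + 4 * lam * u) _ _ (begin
        4 * (X * X + X + lam * β) + (1 + 4 * lam * u)
          ≡⟨ shape₁ X lam β u ⟩
        4 * (X * X + X) + 4 * (lam * (β + u)) + 1
          ≡⟨ cong₂ (λ x y → 4 * (X * X + X) + 4 * (x * y) + 1) lam≡ (suc-injective lam≡) ⟩
        4 * (X * X + X) + 4 * ((suc X + t) * (X + t)) + 1
          ≡⟨ shape₂ X t ⟩
        4 * (2 * (suc X + t) * X) + suc (2 * t) * suc (2 * t)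
          ≡⟨ cong (λ x → 4 * (2 * x * X) + suc (2 * t) * suc (2 * t)) lam≡ ⟨
        4 * (2 * lam * X) + suc (2 * t) * suc (2 * t)
          ≤⟨ +-monoʳ-≤ (4 * (2 * lam * X)) (square-bound (subst (λ a → LeSqrt a _) side le)) ⟩
        4 * (2 * lam * X) + (1 + 4 * lam * u) ∎))
        where
        open ≤-Reasoning
        shape₁ : ∀ X l β u → 4 * (X * X + X + l * β) + (1 + 4 * l * u) ≡ 4 * (X * X + X) + 4 * (l * (β + u)) + 1
        shape₁ = solve-∀
        shape₂ : ∀ X t → 4 * (X * X + X) + 4 * ((suc X + t) * (X + t)) + 1
                       ≡ 4 * (2 * (suc X + t) * X) + suc (2 * t) * suc (2 * t)
        shape₂ = solve-∀

ceiling-bounds : ∀ {β lam c} → 1 ≤ β → β < lam →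
  IsCeilExpr (⁺ lam) (⁺ 1 +ᶻ ⁺ 4 *ᶻ ⁺ lam *ᶻ (⁺ lam -ᶻ ⁺ β -ᶻ ⁺ 1)) c →
  ∃ λ X → c ≡ ⁺ X × 1 ≤ X × X < lam × X * X + X + lam * β ≤ 2 * lam * X
ceiling-bounds {β} 1≤β β<lam ceil with ≤-witness β<lam
... | u , refl = Ceiling.ceiling-bounds {β} {u} 1≤β ceil

-- The two quadratic inequalities are opposite, hence equalities; this forces w = 0 and X = β.
extremal : ∀ {lam X w β} → 1 ≤ X → X + w ≤ β → X * X + X + lam * β ≤ 2 * lam * X →
           lam * X ≤ X * X + X + lam * w → (0 < w → lam * X < X * X + X + lam * w) → lam ≤ suc β
extremal {lam} {X} {zero} 1≤X X+w≤β upper lower lower′ =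
  ≤-trans (*-cancelʳ-≤ lam (suc X) X ⦃ >-nonZero 1≤X ⦄ (begin
        lam * X              ≤⟨ lower ⟩
        X * X + X + lam * 0  ≡⟨ shape X lam ⟩
        suc X * X            ∎)) (s≤s (≤-trans (m≤m+n X 0) X+w≤β))
  where
  open ≤-Reasoning
  shape : ∀ X l → X * X + X + l * 0 ≡ suc X * X
  shape = solve-∀
extremal {lam} {X} {w@(suc _)} {β} 1≤X X+w≤β upper lower lower′ = contradiction (lower′ (s≤s z≤n)) (≤⇒≯ (+-cancelʳ-≤ (lam * X) _ _ (begin
        X * X + X + lam * w + lam * X    ≡⟨ shape₁ X lam w ⟩
        X * X + X + lam * (X + w)        ≤⟨ +-monoʳ-≤ (X * X + X) (*-monoʳ-≤ lam X+w≤β) ⟩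
        X * X + X + lam * β              ≤⟨ upper ⟩
        2 * lam * X                      ≡⟨ shape₂ lam X ⟩
        lam * X + lam * X                ∎)))
  where
  open ≤-Reasoning
  shape₁ : ∀ X l w → X * X + X + l * w + l * X ≡ X * X + X + l * (X + w)
  shape₁ = solve-∀
  shape₂ : ∀ l X → 2 * l * X ≡ l * X + l * X
  shape₂ = solve-∀

module _ {m : ℕ} (1≤m : 1 ≤ m) where
  private
    q : ℕ
    q = suc m

  -- Both truncated subtractions in the equation for l are exact, because r ≤ a and q^k ≥ 1.
  quotient-identity : ∀ {a r k l} → r ≤ a → l * (q ^ k ∸ 1) ≡ q ^ a ∸ q ^ r → q ^ a + l ≡ l * q ^ k + q ^ r
  quotient-identity {a} {r} {k} {l} r≤a l≡ = begin
    q ^ a + l                             ≡⟨ cong (_+ l) (m∸n+n≡m (^-monoʳ-≤ q r≤a)) ⟨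
    q ^ a ∸ q ^ r + q ^ r + l             ≡⟨ cong (λ x → x + q ^ r + l) l≡ ⟨
    l * (q ^ k ∸ 1) + q ^ r + l           ≡⟨ shape l (q ^ k ∸ 1) (q ^ r) ⟩
    l * (q ^ k ∸ 1 + 1) + q ^ r           ≡⟨ cong (λ x → l * x + q ^ r) (m∸n+n≡m (m^n>0 q k)) ⟩
    l * q ^ k + q ^ r                     ∎
    where
    open ≡-Reasoning
    shape : ∀ l a b → l * a + b + l ≡ l * (a + 1) + b
    shape = solve-∀

  ^-cancelʳ-≤ : ∀ {a b} → q ^ a ≤ q ^ b → a ≤ b
  ^-cancelʳ-≤ q^a≤q^b = ≮⇒≥ λ b<a → <⇒≱ (^-monoʳ-< q (s≤s 1≤m) b<a) q^a≤q^b

  spread-bound : (K : FiniteField q) {r z v d e l n X : ℕ} → let k = d + suc e in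
    suc (m * (d + (z + e))) ≡ q ^ r → r ≤ suc e → r < k → v ≡ (v ∸ k) + k → q ^ (v ∸ k) + l ≡ l * q ^ k + q ^ r →
    PartialSpread K v k n →
    1 ≤ X → X < q ^ suc e → X * X + X + q ^ suc e * ((z + e) * m) ≤ 2 * q ^ suc e * X →
    n ≤ l * q ^ k + X
  spread-bound K {r} {z} {v} {d} {e} {l} {n} {X} q^r≡ r≤y r<k v≡ l≡ S 1≤X X<λ upper =
    -- The hole count wants an exact number of members, so a spread beyond the bound is cut down to
    -- l q^k + X + 1 of them.
    ≮⇒≥ λ n> → absurd (Descent.conclusion 1≤m K (restrict n> S) refl 1≤X {r} {d} {e} v≡ l≡ refl X<λ)
    where
    β lam : ℕ
    β = (z + e) * m
    lam = q ^ suc e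
    q^r≡′ : q ^ r ≡ suc (β + d * m)
    q^r≡′ = trans (sym q^r≡) (cong suc (shape m d (z + e)))
      where
      shape : ∀ m d x → m * (d + x) ≡ x * m + d * m
      shape = solve-∀
    absurd : ¬ (∃ λ w → suc (X + w) + d * m ≤ q ^ r
                      × lam * X ≤ X * X + X + lam * w
                      × (0 < w → lam * X < X * X + X + lam * w))
    -- The extremal case gives λ ≤ β + 1 ≤ q^r, hence y ≤ r < k and d > 0. Then β + 1 < β + 1 + d m
    -- = q^r ≤ λ, which closes the circle.
    absurd (w , small , lower , lower′) = <-irrefl refl (begin-strict
      suc β             <⟨ m<m+n (suc β) (*-mono-< {0} {d} {0} {m} 0<d 1≤m) ⟩
      suc β + d * m     ≡⟨ q^r≡′ ⟨
      q ^ r             ≤⟨ ^-monoʳ-≤ q r≤y ⟩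
      lam               ≤⟨ lam≤ ⟩
      suc β             ∎)
      where
      open ≤-Reasoning
      X+w≤β : X + w ≤ β
      X+w≤β = +-cancelʳ-≤ (d * m) _ _ (s≤s⁻¹ (subst (suc (X + w) + d * m ≤_) q^r≡′ small))
      lam≤ : lam ≤ suc β
      lam≤ = extremal 1≤X X+w≤β upper lower lower′
      y≤r : suc e ≤ r
      y≤r = ^-cancelʳ-≤ (≤-trans lam≤ (subst (suc β ≤_) (sym q^r≡′) (m≤m+n (suc β) (d * m))))
      0<d : 0 < d
      0<d = +-cancelʳ-< (suc e) 0 d (≤-<-trans y≤r r<k)

theorem10 : (q : ℕ) (K : FiniteField q) (r t y z k v l : ℕ) →
    1 ≤ r → 2 ≤ t → r ⊔ 2 ≤ y → y ≤ k →
    (q ∸ 1) * (k + z ∸ 1) ≡ q ^ r ∸ 1 →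
    r < k →
    v ≡ k * t + r →
    l * (q ^ k ∸ 1) ≡ q ^ (v ∸ k) ∸ q ^ r →
    (n : ℕ) → PartialSpread K v k n →
    (c : ℤ) →
    IsCeilExpr (⁺ (q ^ y))
    (⁺ 1 +ᶻ ⁺ 4 *ᶻ ⁺ (q ^ y) *ᶻ (⁺ (q ^ y) -ᶻ ⁺ ((z + y ∸ 1) * (q ∸ 1)) -ᶻ ⁺ 1)) c →
    ⁺ n ≤ᶻ ⁺ (l * q ^ k) +ᶻ c
theorem10 zero K = contradiction (field-size>1 K) λ ()
theorem10 (suc m) K r t zero z k v l 1≤r 2≤t r⊔2≤y = contradiction (≤-trans (m≤n⊔m r 2) r⊔2≤y) λ ()
theorem10 (suc m) K r (suc t) (suc e) z k v l 1≤r 2≤t r⊔2≤y y≤k k+z r<k v≡ l≡ n S c ceil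
  with ≤-witness y≤k
... | d , k≡ with trans k≡ (+-comm (suc e) d)
...   | refl = bound (ceiling-bounds 1≤β β<λ (subst Ceil (cong (_∸ 1) (+-suc z e)) ceil))
  where
  q β : ℕ
  q = suc m
  β = (z + e) * m
  Ceil : ℕ → Set
  Ceil x = IsCeilExpr (⁺ (q ^ suc e)) (⁺ 1 +ᶻ ⁺ 4 *ᶻ ⁺ (q ^ suc e) *ᶻ (⁺ (q ^ suc e) -ᶻ ⁺ (x * m) -ᶻ ⁺ 1)) c
  1≤m : 1 ≤ m
  1≤m = s≤s⁻¹ (field-size>1 K)
  r≤y : r ≤ suc e
  r≤y = ≤-trans (m≤m⊔n r 2) r⊔2≤y
  -- From y ≥ 2 comes e ≥ 1, so β ≥ 1; this makes the ceiling positive, and the descent relies on X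
  -- ≥ 1.
  1≤β : 1 ≤ β
  1≤β = *-mono-≤ {1} {z + e} {1} {m} (≤-trans (s≤s⁻¹ (≤-trans (m≤n⊔m r 2) r⊔2≤y)) (m≤n+m e z)) 1≤m
  k+z∸1 : d + suc e + z ∸ 1 ≡ d + (z + e)
  k+z∸1 = cong (_∸ 1) (shape d e z)
    where
    shape : ∀ d e z → d + suc e + z ≡ suc (d + (z + e))
    shape = solve-∀
  q^r≡ : suc (m * (d + (z + e))) ≡ q ^ r
  q^r≡ = trans (cong (λ x → suc (m * x)) (sym k+z∸1)) (trans (cong suc k+z) (m+[n∸m]≡n (m^n>0 q r)))
  β<λ : β < q ^ suc e
  β<λ = begin
    suc ((z + e) * m)         ≡⟨ cong suc (*-comm (z + e) m) ⟩
    suc (m * (z + e))         ≤⟨ s≤s (*-monoʳ-≤ m (m≤n+m (z + e) d)) ⟩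
    suc (m * (d + (z + e)))   ≡⟨ q^r≡ ⟩
    q ^ r                     ≤⟨ ^-monoʳ-≤ q r≤y ⟩
    q ^ suc e                 ∎
    where open ≤-Reasoning
  v∸k : v ∸ k ≡ k * t + r
  v∸k = trans (cong (_∸ k) (trans v≡ (trans (cong (_+ r) (*-suc k t)) (+-assoc k (k * t) r)))) (m+n∸m≡n k _)
  v≡[v∸k]+k : v ≡ (v ∸ k) + k
  v≡[v∸k]+k = trans v≡ (trans (shape k t r) (cong (_+ k) (sym v∸k)))
    where
    shape : ∀ k t r → k * suc t + r ≡ k * t + r + k
    shape = solve-∀
  bound : (∃ λ X → c ≡ ⁺ X × 1 ≤ X × X < q ^ suc e × X * X + X + q ^ suc e * β ≤ 2 * q ^ suc e * X) →
          ⁺ n ≤ᶻ ⁺ (l * q ^ k) +ᶻ c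
  bound (X , refl , 1≤X , X<λ , upper) = +≤+ (spread-bound 1≤m K {z = z} {d = d} {e = e} q^r≡ r≤y r<k v≡[v∸k]+k
    (quotient-identity 1≤m {k = k} {l = l} (subst (r ≤_) (sym v∸k) (m≤n+m r (k * t))) l≡) S 1≤X X<λ upper)
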